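{- For every $\alpha>1$ there is a randomized one-pass streaming algorithm that, given a metric stream of an $n$-point metric $w$, uses $\tilde O(n/\alpha)$ space and with high probability outputs an $\alpha$-approximation of $\mathsf{MST}(w)$, i.e., a value $Y$ with $Y\le\mathsf{MST}(w)\le\alpha Y$.
   Context: A metric stream of a metric $w$ on an $n$-point set $V$ is a stream consisting of all $\binom n2$ entries $(u,v,w(u,v))$, $u\ne v\in V$, presented in an arbitrary (adversarial) order. $\mathsf{MST}(w)$ is the weight of a minimum spanning tree of the complete graph on $V$ weighted by $w$. $\tilde O(\cdot)$ hides polylogarithmic factors in $n$ (space measured in words of $O(\log n)$ bits).
   Formalization: The approximation factor α and the distances w(u,v) are taken rational rather than real; each distance arrives as one word of O(log n) bits under an arbitrary reading of words as numbers, and Õ(n/α) is read as at least one word when α > n. -}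

module Defs where

open import Data.Fin.Base using (Fin)
open import Data.Integer.Base using (+_)
open import Data.List.Base using (List; []; _∷_; [_]; _++_; map; foldr; length; filter; allFin; cartesianProductWith)
open import Data.List.Relation.Unary.All using (All)
open import Data.List.Relation.Unary.AllPairs using (AllPairs)
open import Data.List.Relation.Unary.Any using (Any)
open import Data.List.Relation.Unary.Linked using (Linked)
open import Data.List.Relation.Unary.Unique.Propositional using (Unique)
open import Data.Nat.Base using (ℕ; zero; suc; _^_)
import Data.Nat.Base as ℕ
open import Data.Nat.Logarithm using (⌊log₂_⌋)
open import Data.Product.Base using (_×_; _,_; Σ-syntax; proj₁; uncurry)
open import Data.Rational.Base using (ℚ; 0ℚ; _+_; _*_; _≤_; _/_)
open import Data.Rational.Properties using (_≤?_)
open import Data.Sum.Base using (_⊎_)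
open import Data.Vec.Base using (Vec; []; _∷_)
open import Relation.Binary.Construct.Closure.ReflexiveTransitive using (Star)
open import Relation.Binary.PropositionalEquality.Core using (_≡_; _≢_)
open import Relation.Nullary.Decidable using (Dec; ¬?; _×-dec_)
open import Relation.Nullary.Negation using (¬_)
open import Relation.Unary using (Decidable)

ℕ→ℚ : ℕ → ℚ
ℕ→ℚ n = + n / 1

Edge : ℕ → Set
Edge n = Fin n × Fin n

-- Edges are unordered: (u , v) and (v , u) denote the same one.
SameEdge : ∀ {n} → Edge n → Edge n → Set
SameEdge (a , b) (c , d) = (a ≡ c × b ≡ d) ⊎ (a ≡ d × b ≡ c)

record IsSimple {n} (E : List (Edge n)) : Set where
  field
    loopless : All (uncurry _≢_) E
    distinct : AllPairs (λ e f → ¬ SameEdge e f) E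

Adjacent : ∀ {n} → List (Edge n) → Fin n → Fin n → Set
Adjacent E u v = Any (SameEdge (u , v)) E

Connected : ∀ {n} → List (Edge n) → Set
Connected E = ∀ u v → Star (Adjacent E) u v

-- A cycle visits at least three vertices, all distinct, and returns to
-- the first one.
Acyclic : ∀ {n} → List (Edge n) → Set
Acyclic E = ∀ x y z p → Unique (x ∷ y ∷ z ∷ p) →
            ¬ Linked (Adjacent E) (x ∷ y ∷ z ∷ p ++ [ x ])

record IsSpanningTree {n} (T : List (Edge n)) : Set where
  field
    simple    : IsSimple T
    connected : Connected T
    acyclic   : Acyclic T

weight : ∀ {n} → (Fin n → Fin n → ℚ) → List (Edge n) → ℚ
weight w T = foldr _+_ 0ℚ (map (uncurry w) T)

-- IsMST w m says that MST(w) = m.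
record IsMST {n} (w : Fin n → Fin n → ℚ) (m : ℚ) : Set where
  field
    attained : Σ[ T ∈ List (Edge n) ] (IsSpanningTree T × weight w T ≡ m)
    minimal  : ∀ T → IsSpanningTree T → m ≤ weight w T

-- The bit length of n, equal to Θ(log n) for n ≥ 2 and positive at n = 1.
lg : ℕ → ℕ
lg n = suc ⌊log₂ n ⌋

-- A word of k · lg n bits.
Word : ℕ → ℕ → Set
Word k n = Fin (2 ^ (k ℕ.* lg n))

Entry : ℕ → ℕ → Set
Entry k n = Edge n × Word k n

-- Distances travel in the stream as words; ⟦_⟧ is the number system
-- (integer, fixed point, floating point, …) in which words are read.
-- The order of the entries and the orientation of each pair are arbitrary.
record IsMetricStream (k n : ℕ) (⟦_⟧ : Word k n → ℚ) (w : Fin n → Fin n → ℚ)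
                      (σ : List (Entry k n)) : Set where
  field
    correct  : All (λ ((u , v) , x) → u ≢ v × ⟦ x ⟧ ≡ w u v) σ
    complete : ∀ u v → u ≢ v → Any (λ e → SameEdge (u , v) (proj₁ e)) σ
    distinct : AllPairs (λ e f → ¬ SameEdge (proj₁ e) (proj₁ f)) σ

-- The memory consists of `space` words.  A fresh coin, uniform on
-- Fin (suc coins), is drawn at initialization and at every stream entry;
-- past coins are available later only as far as they are kept in memory.
record StreamingAlgorithm (W E O : Set) : Set where
  field
    space coins : ℕ

  Coin : Set
  Coin = Fin (suc coins)

  State : Set
  State = Vec W space

  field
    init   : Coin → State
    step   : Coin → State → E → State
    output : State → O

  process : (σ : List E) → Vec Coin (length σ) → State → State
  process []      []       s = s
  process (e ∷ σ) (c ∷ cs) s = process σ cs (step c s e)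

  run : (σ : List E) → Vec Coin (suc (length σ)) → O
  run σ (c ∷ cs) = output (process σ cs (init c))

allVecs : ∀ m t → List (Vec (Fin m) t)
allVecs m zero    = [ [] ]
allVecs m (suc t) = cartesianProductWith _∷_ (allFin m) (allVecs m t)

-- P fails with probability at most 1 / N under the uniform distribution
-- on Vec (Fin m) t (denominators cleared).
FailsAtMost1/ : ∀ (N : ℕ) {m t} {P : Vec (Fin m) t → Set} → Decidable P → Set
FailsAtMost1/ N {m} {t} P? =
  length (filter (λ c → ¬? (P? c)) (allVecs m t)) ℕ.* N ℕ.≤ length (allVecs m t)

Approximates : ℚ → ℚ → ℚ → Set
Approximates α m Y = Y ≤ m × m ≤ α * Y

approximates? : ∀ α m Y → Dec (Approximates α m Y)
approximates? α m Y = (Y ≤? m) ×-dec (m ≤? α * Y)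

{-# OPTIONS --safe #-}

-- Sample s ≈ (n / α) log n vertices, keep their exact minimum spanning forest
-- (Kruskal, re-run on the stored forest whenever an entry arrives; its cost is Z)
-- and the largest distance L.  For α < 16 keep all vertices: Z is then exact.
-- Otherwise output (Z + L) / 4, which is at most MST because a tour of length
-- 2 MST visits all vertices and can be shortcut to the samples.
-- For the upper bound list the vertices in the order in which Prim's algorithm
-- reaches them, with gaps g₁ , g₂ , … (the weights of the attaching edges), so
-- that w (u , v) dominates every gap between u and v and MST = Σ gᵢ.  With high
-- probability every aligned block of q = ⌊α / 16⌋ positions contains a sample.
-- Gaps in one residue class modulo 2 q are then separated by samples, so any tree
-- on the samples pays for all of them except the first and the last, and summing
-- over the 2 q classes gives MST ≤ 2 q (Z + 2 L).
module Submission where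

open import Defs

module Kruskal-Forests where

  open import Data.Bool.Base using (if_then_else_)
  open import Data.List.Base using (List; []; _∷_; map; foldr; length; filter)
  open import Data.List.Membership.Propositional using (_∈_)
  open import Data.List.Membership.Propositional.Properties using (∈-filter⁺)
  open import Data.List.Properties using (filter-notAll)
  open import Data.List.Relation.Unary.All as All using (All; []; _∷_)
  open import Data.List.Relation.Unary.AllPairs using (AllPairs; []; _∷_)
  open import Data.List.Relation.Unary.Any as Any using (Any; here; there)
  import Data.Nat.Base as ℕ
  import Data.Nat.Properties as ℕ
  open import Data.Product.Base using (_×_; _,_; proj₂)
  open import Data.Rational.Base using (ℚ; 0ℚ; _+_; _≤_)
  open import Data.Rational.Properties as ℚ using (_≤?_)
  open import Function.Base using (id; _∘_)
  open import Level using (0ℓ)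
  open import Relation.Binary.Core using (Rel)
  open import Relation.Binary.Definitions using (DecidableEquality; Symmetric)
  open import Relation.Binary.PropositionalEquality using (_≡_; _≢_; refl; sym; trans; cong; cong₂; module ≡-Reasoning)
  open import Relation.Binary.Structures using (IsEquivalence)
  import Relation.Binary.Construct.On as On
  open import Relation.Binary.PropositionalEquality.Properties using (isEquivalence)
  open import Relation.Nullary.Decidable using (Dec; yes; no; does; ¬?)
  open import Relation.Nullary.Negation using (contradiction)

  sumBy : {A : Set} → (A → ℚ) → List A → ℚ
  sumBy f = foldr (λ x r → f x + r) 0ℚ

  ≤-resp : ∀ {a b c d : ℚ} → a ≡ b → c ≡ d → b ≤ d → a ≤ c
  ≤-resp refl refl p = p

  p≤q+p : ∀ {p q : ℚ} → 0ℚ ≤ q → p ≤ q + p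
  p≤q+p {p} {q} 0≤q = ≤-resp (sym (ℚ.+-identityˡ p)) refl (ℚ.+-monoˡ-≤ p 0≤q)

  -- A partition of X is a labelling c : X → X; two points are in the same
  -- class when their labels agree.
  module Labellings {X : Set} (_≟_ : DecidableEquality X) where

    Same : (X → X) → Rel X 0ℓ
    Same c x y = c x ≡ c y

    Same-isEquivalence : ∀ c → IsEquivalence (Same c)
    Same-isEquivalence c = On.isEquivalence c isEquivalence

    infix 4 _⊑_
    _⊑_ : (X → X) → Rel X 0ℓ → Set
    c ⊑ R = ∀ {x y} → c x ≡ c y → R x y

    relabel : X → X → X → X
    relabel p q z = if does (z ≟ p) then q else z

    merge : (X → X) → X → X → X → X
    merge c a b x = relabel (c a) (c b) (c x)

    merge-mono : ∀ c a b → c ⊑ Same (merge c a b)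
    merge-mono c a b = cong (relabel (c a) (c b))

    merge-joins : ∀ c a b → Same (merge c a b) a b
    merge-joins c a b with c a ≟ c a | c b ≟ c a
    ... | no ¬p | _     = contradiction refl ¬p
    ... | yes _ | yes _ = refl
    ... | yes _ | no _  = refl

    merge-least : ∀ {R} → IsEquivalence R → ∀ c a b → c ⊑ R → R a b → merge c a b ⊑ R
    merge-least eq c a b c⊑R Rab {x} {y} same with c x ≟ c a | c y ≟ c a
    ... | yes p | yes q = c⊑R (trans p (sym q))
    ... | yes p | no _  = IsEquivalence.trans eq (c⊑R p) (IsEquivalence.trans eq Rab (c⊑R same))
    ... | no _  | yes q = IsEquivalence.trans eq (c⊑R same)
                            (IsEquivalence.trans eq (IsEquivalence.sym eq Rab) (c⊑R (sym q)))
    ... | no _  | no _  = c⊑R same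

    merge-exchange : ∀ c a b x y → c x ≢ c y →
                     Same (merge c a b) x y → Same (merge c x y) a b
    merge-exchange c a b x y x≁y same with c x ≟ c a | c y ≟ c a
    ... | yes p | yes q = contradiction (trans p (sym q)) x≁y
    ... | yes p | no _  = trans (merge-mono c x y (sym p))
                            (trans (merge-joins c x y) (merge-mono c x y (sym same)))
    ... | no _  | yes q = trans (merge-mono c x y (sym q))
                            (trans (sym (merge-joins c x y)) (merge-mono c x y same))
    ... | no _  | no _  = contradiction same x≁y

    mergeAll : (X → X) → List (X × X × ℚ) → X → X
    mergeAll c []                  = c
    mergeAll c ((a , b , _) ∷ fs) = mergeAll (merge c a b) fs

    mergeAll-mono : ∀ c fs → c ⊑ Same (mergeAll c fs)
    mergeAll-mono c []                  p = p
    mergeAll-mono c ((a , b , _) ∷ fs) p = mergeAll-mono _ fs (merge-mono c a b p)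

    mergeAll-joins : ∀ (c : X → X) (fs : List (X × X × ℚ)) → All (λ (a , b , _) → Same (mergeAll c fs) a b) fs
    mergeAll-joins c []                  = []
    mergeAll-joins c ((a , b , _) ∷ fs) =
      mergeAll-mono _ fs (merge-joins c a b) ∷ mergeAll-joins _ fs

  total : {X : Set} → List (X × X × ℚ) → ℚ
  total = sumBy (proj₂ ∘ proj₂)

  module Kruskal {X : Set} (_≟_ : DecidableEquality X)
                 {E : Set} (src tgt : E → X) (key : E → ℚ) where

    open Labellings _≟_ public

    join : (X → X) → E → X → X
    join c e = merge c (src e) (tgt e)

    kruskal : (X → X) → List E → List E
    kruskal c []      = []
    kruskal c (e ∷ L) with c (src e) ≟ c (tgt e)
    ... | yes _ = kruskal c L
    ... | no _  = e ∷ kruskal (join c e) L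

    cost : List E → ℚ
    cost = sumBy key

    Sorted : List E → Set
    Sorted = AllPairs (λ e f → key e ≤ key f)

    insert : E → List E → List E
    insert e []      = e ∷ []
    insert e (f ∷ L) with key e ≤? key f
    ... | yes _ = e ∷ f ∷ L
    ... | no _  = f ∷ insert e L

    kruskal-skip : ∀ {c e} L → c (src e) ≡ c (tgt e) → kruskal c (e ∷ L) ≡ kruskal c L
    kruskal-skip {c} {e} L p with c (src e) ≟ c (tgt e)
    ... | yes _ = refl
    ... | no ¬p = contradiction p ¬p

    kruskal-take : ∀ {c e} L → c (src e) ≢ c (tgt e) →
                   kruskal c (e ∷ L) ≡ e ∷ kruskal (join c e) L
    kruskal-take {c} {e} L ¬p with c (src e) ≟ c (tgt e)
    ... | yes p = contradiction p ¬p
    ... | no _  = refl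

    join-mono : ∀ {c c'} e → c ⊑ Same c' → join c e ⊑ Same (join c' e)
    join-mono {c} {c'} e c⊑c' =
      merge-least (Same-isEquivalence (join c' e)) c (src e) (tgt e)
        (λ p → merge-mono c' (src e) (tgt e) (c⊑c' p)) (merge-joins c' (src e) (tgt e))

    kruskal-cong : ∀ {c c'} → c ⊑ Same c' → c' ⊑ Same c → ∀ L → kruskal c L ≡ kruskal c' L
    kruskal-cong         f g []      = refl
    kruskal-cong {c} {c'} f g (e ∷ L) with c (src e) ≟ c (tgt e)
    ... | yes p = trans (kruskal-cong f g L) (sym (kruskal-skip L (f p)))
    ... | no ¬p = trans (cong (e ∷_) (kruskal-cong (join-mono {c} {c'} e f) (join-mono {c'} {c} e g) L))
                        (sym (kruskal-take L (¬p ∘ g)))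

    kruskal-absorb : ∀ {c c'} → c ⊑ Same c' → ∀ L → kruskal c' (kruskal c L) ≡ kruskal c' L
    kruskal-absorb         f []      = refl
    kruskal-absorb {c} {c'} f (e ∷ L) with c (src e) ≟ c (tgt e)
    ... | yes p = trans (kruskal-absorb f L) (sym (kruskal-skip L (f p)))
    ... | no _ with c' (src e) ≟ c' (tgt e)
    ...   | no _  = cong (e ∷_) (kruskal-absorb (join-mono {c} {c'} e f) L)
    ...   | yes q = kruskal-absorb (merge-least (Same-isEquivalence c') c (src e) (tgt e) f q) L

    kruskal-all : ∀ {P : E → Set} {c} L → All P L → All P (kruskal c L)
    kruskal-all         []      []        = []
    kruskal-all {c = c} (e ∷ L) (p ∷ ps) with c (src e) ≟ c (tgt e)
    ... | yes _ = kruskal-all L ps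
    ... | no _  = p ∷ kruskal-all L ps

    kruskal-loopless : ∀ {c} L → All (λ e → src e ≢ tgt e) (kruskal c L)
    kruskal-loopless         []      = []
    kruskal-loopless {c} (e ∷ L) with c (src e) ≟ c (tgt e)
    ... | yes _ = kruskal-loopless L
    ... | no ¬p = ¬p ∘ cong c ∷ kruskal-loopless L

    kruskal-redundant : ∀ {c} L → All (λ e → c (src e) ≡ c (tgt e)) L → kruskal c L ≡ []
    kruskal-redundant []      []       = refl
    kruskal-redundant (e ∷ L) (p ∷ ps) = trans (kruskal-skip L p) (kruskal-redundant L ps)

    kruskal-spans : ∀ {R} → IsEquivalence R → ∀ {c} → c ⊑ R → ∀ L →
                    All (λ e → R (src e) (tgt e)) (kruskal c L) →
                    All (λ e → R (src e) (tgt e)) L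
    kruskal-spans eq         c⊑R []      _ = []
    kruskal-spans eq {c} c⊑R (e ∷ L) rs with c (src e) ≟ c (tgt e)
    kruskal-spans eq c⊑R (e ∷ L) rs       | yes p = c⊑R p ∷ kruskal-spans eq c⊑R L rs
    kruskal-spans eq c⊑R (e ∷ L) (r ∷ rs) | no _  =
      r ∷ kruskal-spans eq (merge-least eq _ (src e) (tgt e) c⊑R r) L rs

    insert-all : ∀ {P : E → Set} {e} L → P e → All P L → All P (insert e L)
    insert-all         []      pe []       = pe ∷ []
    insert-all {e = e} (f ∷ L) pe (p ∷ ps) with key e ≤? key f
    ... | yes _ = pe ∷ p ∷ ps
    ... | no _  = p ∷ insert-all L pe ps

    insert-here : ∀ {P : E → Set} {e} L → P e → Any P (insert e L)
    insert-here         []      pe = here pe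
    insert-here {e = e} (f ∷ L) pe with key e ≤? key f
    ... | yes _ = here pe
    ... | no _  = there (insert-here L pe)

    insert-there : ∀ {P : E → Set} {e} L → Any P L → Any P (insert e L)
    insert-there {e = e} (f ∷ L) p with key e ≤? key f
    insert-there (f ∷ L) p         | yes _ = there p
    insert-there (f ∷ L) (here p)  | no _  = here p
    insert-there (f ∷ L) (there p) | no _  = there (insert-there L p)

    insert-min : ∀ {e} L → All (λ f → key e ≤ key f) L → insert e L ≡ e ∷ L
    insert-min         []      _       = refl
    insert-min {e} (f ∷ L) (p ∷ _) with key e ≤? key f
    ... | yes _ = refl
    ... | no ¬p = contradiction p ¬p

    insert-sorted : ∀ {e} L → Sorted L → Sorted (insert e L)
    insert-sorted         []      []       = [] ∷ []
    insert-sorted {e} (f ∷ L) (p ∷ ps) with key e ≤? key f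
    ... | yes q = (q ∷ All.map (ℚ.≤-trans q) p) ∷ p ∷ ps
    ... | no ¬q = insert-all L (ℚ.<⇒≤ (ℚ.≰⇒> ¬q)) p ∷ insert-sorted L ps

    insert-pairs : ∀ {R : Rel E 0ℓ} → Symmetric R → ∀ {e} L → All (R e) L → AllPairs R L →
                   AllPairs R (insert e L)
    insert-pairs sy         []      []       []       = [] ∷ []
    insert-pairs sy {e} (f ∷ L) (r ∷ rs) (p ∷ ps) with key e ≤? key f
    ... | yes q = (r ∷ rs) ∷ p ∷ ps
    ... | no ¬q = insert-all L (sy r) p ∷ insert-pairs sy L rs ps

    insert-cost : ∀ e L → cost (insert e L) ≡ key e + cost L
    insert-cost e []      = refl
    insert-cost e (f ∷ L) with key e ≤? key f
    ... | yes _ = refl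
    ... | no _  = begin
      key f + cost (insert e L)  ≡⟨ cong (key f +_) (insert-cost e L) ⟩
      key f + (key e + cost L)   ≡⟨ ℚ.+-assoc (key f) (key e) (cost L) ⟨
      (key f + key e) + cost L   ≡⟨ cong (_+ cost L) (ℚ.+-comm (key f) (key e)) ⟩
      (key e + key f) + cost L   ≡⟨ ℚ.+-assoc (key e) (key f) (cost L) ⟩
      key e + (key f + cost L)   ∎
      where open ≡-Reasoning

    kruskal-insert : ∀ c e L → Sorted L →
                     kruskal c (insert e (kruskal c L)) ≡ kruskal c (insert e L)
    kruskal-insert c e []      _ = refl
    kruskal-insert c e (f ∷ L) (p ∷ ps) with key e ≤? key f
    ... | yes q = trans (cong (kruskal c) (insert-min _ (kruskal-all (f ∷ L) (q ∷ All.map (ℚ.≤-trans q) p))))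
                        lemma
      where
      lemma : kruskal c (e ∷ kruskal c (f ∷ L)) ≡ kruskal c (e ∷ f ∷ L)
      lemma with c (src e) ≟ c (tgt e)
      ... | yes _ = kruskal-absorb id (f ∷ L)
      ... | no _  = cong (e ∷_) (kruskal-absorb (merge-mono c (src e) (tgt e)) (f ∷ L))
    ... | no ¬q with c (src f) ≟ c (tgt f)
    ...   | yes _ = kruskal-insert c e L ps
    ...   | no ¬r with key e ≤? key f
    ...     | yes q = contradiction q ¬q
    ...     | no _  = trans (kruskal-take _ ¬r) (cong (f ∷_) (kruskal-insert (join c f) e L ps))

    -- Every accepted edge removes one label from the list of live labels.
    kruskal-length : ∀ {c} (S R : List X) → (∀ {x} → x ∈ S → c x ∈ R) → ∀ L →
                     All (λ e → src e ∈ S × tgt e ∈ S) L → length (kruskal c L) ℕ.≤ length R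
    kruskal-length         S R live []      _              = ℕ.z≤n
    kruskal-length {c} S R live (e ∷ L) ((s , t) ∷ es) with c (src e) ≟ c (tgt e)
    ... | yes _ = kruskal-length S R live L es
    ... | no ¬p = ℕ.≤-trans (ℕ.s≤s (kruskal-length S R' live' L es))
                    (filter-notAll keep? R (Any.map (λ eq ¬eq → ¬eq (sym eq)) (live s)))
      where
      keep? : ∀ x → Dec (x ≢ c (src e))
      keep? x = ¬? (x ≟ c (src e))
      R' = filter keep? R
      live' : ∀ {x} → x ∈ S → join c e x ∈ R'
      live' {x} x∈S with c x ≟ c (src e)
      ... | yes _ = ∈-filter⁺ keep? (live t) (¬p ∘ sym)
      ... | no ¬q = ∈-filter⁺ keep? (live x∈S) ¬q

    -- a and b are joined by the partition c together with the edges of L of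
    -- key at most r.
    Spans : (X → X) → List E → X → X → ℚ → Set
    Spans c L a b r = ∀ c' → c ⊑ Same c' → All (λ e → key e ≤ r → Same c' (src e) (tgt e)) L →
                      Same c' a b

    -- If e becomes redundant once a and b are merged, then merging the ends of e
    -- instead gives the same partition, and key e ≤ r since a and b were spanned.
    kruskal-merge : ∀ {r} → 0ℚ ≤ r → ∀ c L a b → Sorted L → Spans c L a b r →
                    cost (kruskal c L) ≤ r + cost (kruskal (merge c a b) L)
    kruskal-merge {r} 0≤r c []      a b _        _  = ≤-resp refl (ℚ.+-identityʳ r) 0≤r
    kruskal-merge {r} 0≤r c (e ∷ L) a b (p ∷ ps) sp with c (src e) ≟ c (tgt e)
    ... | yes q = ≤-resp refl (cong (λ K → r + cost K) (kruskal-skip L (merge-mono c a b q)))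
                    (kruskal-merge 0≤r c L a b ps (λ c' f g → sp c' f ((λ _ → f q) ∷ g)))
    ... | no ¬q with merge c a b (src e) ≟ merge c a b (tgt e)
    ...   | yes same = ≤-resp refl (cong (λ K → r + cost K) (kruskal-cong ab⊑e e⊑ab L))
                         (ℚ.+-monoˡ-≤ (cost (kruskal (join c e) L)) key≤r)
      where
      e⊑ab : join c e ⊑ Same (merge c a b)
      e⊑ab = merge-least (Same-isEquivalence (merge c a b)) c (src e) (tgt e) (merge-mono c a b) same
      ab⊑e : merge c a b ⊑ Same (join c e)
      ab⊑e = merge-least (Same-isEquivalence (join c e)) c a b (merge-mono c (src e) (tgt e))
               (merge-exchange c a b (src e) (tgt e) ¬q same)
      key≤r : key e ≤ r
      key≤r with key e ≤? r
      ... | yes k≤r = k≤r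
      ... | no k≰r  = contradiction (merge-least (Same-isEquivalence c) c a b id a~b same) ¬q
        where
        a~b = sp c id ((λ k≤r → contradiction k≤r k≰r) ∷
                       All.map (λ k≤k' k'≤r → contradiction (ℚ.≤-trans k≤k' k'≤r) k≰r) p)
    ...   | no _ = begin
      key e + cost (kruskal ce L)               ≤⟨ ℚ.+-monoʳ-≤ (key e) ih ⟩
      key e + (r + cost (kruskal (merge ce a b) L)) ≡⟨ ℚ.+-assoc (key e) r _ ⟨
      (key e + r) + cost (kruskal (merge ce a b) L) ≡⟨ cong₂ (λ x K → x + cost K) (ℚ.+-comm (key e) r) (kruskal-cong f g L) ⟩
      (r + key e) + cost (kruskal (join (merge c a b) e) L) ≡⟨ ℚ.+-assoc r (key e) _ ⟩
      r + (key e + cost (kruskal (join (merge c a b) e) L)) ∎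
      where
      open ℚ.≤-Reasoning
      ce = join c e
      ih = kruskal-merge 0≤r ce L a b ps
             (λ c' h k → sp c' (λ x → h (merge-mono c (src e) (tgt e) x))
                           ((λ _ → h (merge-joins c (src e) (tgt e))) ∷ k))
      f : merge ce a b ⊑ Same (join (merge c a b) e)
      f = merge-least (Same-isEquivalence (join (merge c a b) e)) ce a b (join-mono {c} {merge c a b} e (merge-mono c a b))
            (merge-mono (merge c a b) (src e) (tgt e) (merge-joins c a b))
      g : join (merge c a b) e ⊑ Same (merge ce a b)
      g = merge-least (Same-isEquivalence (merge ce a b)) (merge c a b) (src e) (tgt e)
            (merge-least (Same-isEquivalence (merge ce a b)) c a b
              (λ x → merge-mono ce a b (merge-mono c (src e) (tgt e) x)) (merge-joins ce a b))
            (merge-mono ce a b (merge-joins c (src e) (tgt e)))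

    kruskal-mergeAll : ∀ c L fs → Sorted L → All (λ (a , b , r) → 0ℚ ≤ r × Spans c L a b r) fs →
                       cost (kruskal c L) ≤ total fs + cost (kruskal (mergeAll c fs) L)
    kruskal-mergeAll c L []                 so []                 =
      ≤-resp refl (ℚ.+-identityˡ _) ℚ.≤-refl
    kruskal-mergeAll c L ((a , b , r) ∷ fs) so ((0≤r , sp) ∷ ps) = begin
      cost (kruskal c L)                     ≤⟨ kruskal-merge 0≤r c L a b so sp ⟩
      r + cost (kruskal (merge c a b) L)     ≤⟨ ℚ.+-monoʳ-≤ r ih ⟩
      r + (total fs + rest)                  ≡⟨ ℚ.+-assoc r (total fs) rest ⟨
      (r + total fs) + rest                  ∎
      where
      open ℚ.≤-Reasoning
      rest = cost (kruskal (mergeAll (merge c a b) fs) L)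
      ih = kruskal-mergeAll (merge c a b) L fs so
             (All.map (λ (0≤r , sp) → 0≤r , λ c″ g → sp c″ (λ x → g (merge-mono c a b x))) ps)

    kruskal-optimal : ∀ L fs → Sorted L → All (λ (a , b , r) → 0ℚ ≤ r × Spans id L a b r) fs →
                      (∀ c → All (λ (a , b , _) → c a ≡ c b) fs → All (λ e → c (src e) ≡ c (tgt e)) L) →
                      cost (kruskal id L) ≤ total fs
    kruskal-optimal L fs so sp conn =
      ≤-resp refl (trans (sym (ℚ.+-identityʳ _)) (cong (λ K → total fs + cost K) (sym none)))
        (kruskal-mergeAll id L fs so sp)
      where
      none = kruskal-redundant L (conn (mergeAll id fs) (mergeAll-joins id fs))

module Prim-Tours where

  open import Data.Fin.Base using (toℕ)
  open import Data.List.Base using (List; []; _∷_; _++_; map; length; filter; cartesianProduct)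
  open import Data.List.Membership.Propositional using (_∈_)
  open import Data.List.Membership.Propositional.Properties using (∈-∃++; ∈-cartesianProduct⁺; ∈-cartesianProduct⁻)
  open import Data.List.Relation.Binary.Permutation.Propositional using (_↭_; ↭-refl; ↭-sym; ↭-trans; prep)
  open import Data.List.Relation.Binary.Permutation.Propositional.Properties using (shift; ∈-resp-↭; ↭-length)
  open import Data.List.Relation.Unary.All as All using (All; []; _∷_)
  open import Data.List.Relation.Unary.AllPairs using (AllPairs; []; _∷_)
  open import Data.List.Relation.Unary.Any as Any using (Any; here; there)
  open import Data.Nat.Base as ℕ using (ℕ; zero; suc; s≤s)
  import Data.Nat.Properties as ℕ
  open import Data.Product.Base using (_×_; _,_; proj₁; proj₂; Σ-syntax; uncurry)
  open import Data.Rational.Base using (ℚ; 0ℚ; _+_; _≤_)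
  open import Data.Rational.Properties as ℚ using (_≤?_)
  open import Data.Rational.Solver using (module +-*-Solver)
  open import Data.Sum.Base using (_⊎_; inj₁; inj₂)
  open import Function.Base using (id; _∘_)
  open import Relation.Binary.PropositionalEquality using (_≡_; _≢_; refl; sym; trans; cong; subst; module ≡-Reasoning)
  open import Relation.Nullary.Decidable using (yes; no; does; dec-true; dec-false)
  open import Relation.Nullary.Negation using (contradiction)
  open import Relation.Unary using (Decidable)
  open import Data.Bool.Base using (if_then_else_)
  open Kruskal-Forests

  +-leftComm : ∀ a b c → a + (b + c) ≡ b + (a + c)
  +-leftComm = solve 3 (λ a b c → a :+ (b :+ c) := b :+ (a :+ c)) refl
    where open +-*-Solver

  detour-sum : ∀ p q r → p + ((p + q) + r) ≡ (q + r) + (p + p)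
  detour-sum = solve 3 (λ p q r → p :+ ((p :+ q) :+ r) := (q :+ r) :+ (p :+ p)) refl
    where open +-*-Solver

  double-sum : ∀ p q r → (p + (q + q)) + (r + r) ≡ p + ((q + r) + (q + r))
  double-sum = solve 3 (λ p q r → (p :+ (q :+ q)) :+ (r :+ r) := p :+ ((q :+ r) :+ (q :+ r))) refl
    where open +-*-Solver

  sumTo : (ℕ → ℚ) → ℕ → ℚ
  sumTo g zero    = 0ℚ
  sumTo g (suc k) = g k + sumTo g k

  Crosses : ℕ → ℕ → ℕ → Set
  Crosses j a b = (a ℕ.≤ j × j ℕ.< b) ⊎ (b ℕ.≤ j × j ℕ.< a)

  -- The path 0 - 1 - 2 - ⋯ whose edge j joins j and suc j and has key g j.
  module Path (g : ℕ → ℚ) where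

    open Kruskal ℕ._≟_ {ℕ} id suc g

    sortedPath : ℕ → List ℕ
    sortedPath zero    = []
    sortedPath (suc k) = insert k (sortedPath k)

    path-sorted : ∀ k → Sorted (sortedPath k)
    path-sorted zero    = []
    path-sorted (suc k) = insert-sorted _ (path-sorted k)

    path-cost : ∀ k → cost (sortedPath k) ≡ sumTo g k
    path-cost zero    = refl
    path-cost (suc k) = trans (insert-cost k (sortedPath k)) (cong (g k +_) (path-cost k))

    path-< : ∀ k → All (ℕ._< k) (sortedPath k)
    path-< zero    = []
    path-< (suc k) = insert-all _ ℕ.≤-refl (All.map ℕ.m<n⇒m<1+n (path-< k))

    path-distinct : ∀ k → AllPairs _≢_ (sortedPath k)
    path-distinct zero    = []
    path-distinct (suc k) =
      insert-pairs (_∘ sym) _ (All.map (ℕ.>⇒≢) (path-< k)) (path-distinct k)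

    path-complete : ∀ {j} k → j ℕ.< k → j ∈ sortedPath k
    path-complete {j} (suc k) j<1+k with j ℕ.≟ k
    ... | yes refl = insert-here (sortedPath k) refl
    ... | no j≢k   = insert-there (sortedPath k)
                       (path-complete k (ℕ.≤∧≢⇒< (ℕ.≤-pred j<1+k) j≢k))

    cut : ℕ → ℕ → ℕ
    cut j x = if does (x ℕ.≤? j) then 0 else 1

    cut-low : ∀ {j x} → x ℕ.≤ j → cut j x ≡ 0
    cut-low {j} {x} x≤j = cong (if_then 0 else 1) (dec-true (x ℕ.≤? j) x≤j)

    cut-high : ∀ {j x} → j ℕ.< x → cut j x ≡ 1
    cut-high {j} {x} j<x = cong (if_then 0 else 1) (dec-false (x ℕ.≤? j) (ℕ.<⇒≱ j<x))

    cut-splits : ∀ j → cut j j ≢ cut j (suc j)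
    cut-splits j eq = contradiction (trans (sym (cut-low {j} ℕ.≤-refl)) (trans eq (cut-high {j} ℕ.≤-refl))) λ ()

    cut-spares : ∀ {i j} → i ≢ j → cut j i ≡ cut j (suc i)
    cut-spares {i} {j} i≢j with ℕ.≤-<-connex i j
    ... | inj₁ i≤j = trans (cut-low i≤j) (sym (cut-low (ℕ.≤∧≢⇒< i≤j i≢j)))
    ... | inj₂ j<i = trans (cut-high j<i) (sym (cut-high (ℕ.m<n⇒m<1+n j<i)))

    kruskal-path : ∀ c L → AllPairs _≢_ L → All (λ j → c ⊑ Same (cut j)) L → kruskal c L ≡ L
    kruskal-path c []      _          _          = refl
    kruskal-path c (i ∷ L) (i≢ ∷ dis) (c⊑ ∷ c⊑s) =
      trans (kruskal-take {c} L (λ p → cut-splits i (c⊑ p)))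
        (cong (i ∷_) (kruskal-path (join c i) L dis (spared i≢ c⊑s)))
      where
      spared : ∀ {M} → All (i ≢_) M → All (λ j → c ⊑ Same (cut j)) M →
               All (λ j → join c i ⊑ Same (cut j)) M
      spared []         []        = []
      spared (_∷_ {j} i≢j is) (c⊑j ∷ cs) =
        merge-least (Same-isEquivalence (cut j)) c i (suc i) c⊑j (cut-spares i≢j) ∷ spared is cs

    chain : ∀ (c : ℕ → ℕ) a d → (∀ j → a ℕ.≤ j → j ℕ.< d ℕ.+ a → c j ≡ c (suc j)) → c a ≡ c (d ℕ.+ a)
    chain c a zero    f = refl
    chain c a (suc d) f = trans (chain c a d (λ j a≤j j<d → f j a≤j (ℕ.m<n⇒m<1+n j<d)))
                                (f (d ℕ.+ a) (ℕ.m≤n+m a d) ℕ.≤-refl)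

    chain≤ : ∀ (c : ℕ → ℕ) {a b} → a ℕ.≤ b → (∀ j → a ℕ.≤ j → j ℕ.< b → c j ≡ c (suc j)) → c a ≡ c b
    chain≤ c {a} {b} a≤b f = subst (λ x → c a ≡ c x) (ℕ.m∸n+n≡m a≤b)
      (chain c a (b ℕ.∸ a) (λ j a≤j j<b → f j a≤j (subst (j ℕ.<_) (ℕ.m∸n+n≡m a≤b) j<b)))

    Dominating : ℕ → ℕ × ℕ × ℚ → Set
    Dominating k (a , b , r) = 0ℚ ≤ r × (a ℕ.≤ k × b ℕ.≤ k) × (∀ j → j ℕ.< k → Crosses j a b → g j ≤ r)

    gaps≤connecting : ∀ k fs → All (Dominating k) fs →
      (∀ c → All (λ (a , b , _) → c a ≡ c b) fs → ∀ j → j ℕ.< k → c j ≡ c (suc j)) →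
      sumTo g k ≤ total fs
    gaps≤connecting k fs edges conn =
      ≤-resp (trans (sym (path-cost k)) (cong cost (sym accepted))) refl
        (kruskal-optimal (sortedPath k) fs (path-sorted k) (All.map spans edges)
          (λ c joined → All.map (conn c joined _) (path-< k)))
      where
      accepted : kruskal id (sortedPath k) ≡ sortedPath k
      accepted = kruskal-path id (sortedPath k) (path-distinct k)
                   (All.universal {P = λ j → id ⊑ Same (cut j)} (λ j → cong (cut j)) _)
      spans : ∀ {f : ℕ × ℕ × ℚ} → Dominating k f →
              0ℚ ≤ proj₂ (proj₂ f) × Spans id (sortedPath k) (proj₁ f) (proj₁ (proj₂ f)) (proj₂ (proj₂ f))
      spans {a , b , r} (0≤r , (a≤k , b≤k) , cross) = 0≤r , span
        where
        span : Spans id (sortedPath k) a b r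
        span c _ joins with ℕ.≤-total a b
        ... | inj₁ a≤b = chain≤ c a≤b λ j a≤j j<b →
          All.lookup joins (path-complete k (ℕ.<-≤-trans j<b b≤k)) (cross j (ℕ.<-≤-trans j<b b≤k) (inj₁ (a≤j , j<b)))
        ... | inj₂ b≤a = sym (chain≤ c b≤a λ j b≤j j<a →
          All.lookup joins (path-complete k (ℕ.<-≤-trans j<a a≤k)) (cross j (ℕ.<-≤-trans j<a a≤k) (inj₂ (b≤j , j<a))))

  at : List ℚ → ℕ → ℚ
  at []       _       = 0ℚ
  at (g ∷ _)  zero    = g
  at (_ ∷ gs) (suc j) = at gs j

  at-all : ∀ {P : ℚ → Set} → P 0ℚ → ∀ gs → All P gs → ∀ j → P (at gs j)
  at-all p0 []       _        j       = p0
  at-all p0 (g ∷ gs) (p ∷ ps) zero    = p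
  at-all p0 (g ∷ gs) (p ∷ ps) (suc j) = at-all p0 gs ps j

  at-beyond : ∀ gs j → length gs ℕ.≤ j → at gs j ≡ 0ℚ
  at-beyond []       j       _       = refl
  at-beyond (g ∷ gs) (suc j) (s≤s p) = at-beyond gs j p

  sumTo-head : ∀ f k → sumTo f (suc k) ≡ f 0 + sumTo (f ∘ suc) k
  sumTo-head f zero    = refl
  sumTo-head f (suc k) = begin
    f (suc k) + sumTo f (suc k)             ≡⟨ cong (f (suc k) +_) (sumTo-head f k) ⟩
    f (suc k) + (f 0 + sumTo (f ∘ suc) k)   ≡⟨ +-leftComm (f (suc k)) (f 0) (sumTo (f ∘ suc) k) ⟩
    f 0 + (f (suc k) + sumTo (f ∘ suc) k)   ∎
    where open ≡-Reasoning

  sumTo-at : ∀ gs → sumTo (at gs) (length gs) ≡ sumBy id gs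
  sumTo-at []       = refl
  sumTo-at (g ∷ gs) = trans (sumTo-head (at (g ∷ gs)) (length gs)) (cong (g +_) (sumTo-at gs))

  index : {V : Set} {x : V} {L : List V} → x ∈ L → ℕ
  index = toℕ ∘ Any.index

  minimiser : {A : Set} (f : A → ℚ) (x : A) (xs : List A) →
              Σ[ y ∈ A ] (y ∈ x ∷ xs × (∀ {z} → z ∈ x ∷ xs → f y ≤ f z))
  minimiser f x []        = x , here refl , λ { (here refl) → ℚ.≤-refl }
  minimiser f x (x' ∷ xs) with minimiser f x' xs
  ... | y , y∈ , least with f x ≤? f y
  ...   | yes p = x , here refl , λ { (here refl) → ℚ.≤-refl ; (there z∈) → ℚ.≤-trans p (least z∈) }
  ...   | no ¬p = y , there y∈ , λ { (here refl) → ℚ.<⇒≤ (ℚ.≰⇒> ¬p) ; (there z∈) → least z∈ }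

  module Space {V : Set} (w : V → V → ℚ)
               (w-nonneg : ∀ x y → 0ℚ ≤ w x y) (w-sym : ∀ x y → w x y ≡ w y x)
               (w-tri : ∀ x y z → w x z ≤ w x y + w y z) where

    -- Prim A R gs: when A has been reached, Prim's algorithm may go on to reach
    -- the vertices R in this order, along edges of weights gs.
    data Prim (A : List V) : List V → List ℚ → Set where
      []   : Prim A [] []
      grow : ∀ {a x R gs} → a ∈ A → (∀ {u z} → u ∈ A → z ∈ x ∷ R → w a x ≤ w u z) →
             Prim (x ∷ A) R gs → Prim A (x ∷ R) (w a x ∷ gs)

    nearest : ∀ a A r R → Σ[ b ∈ V ] Σ[ x ∈ V ]
              (b ∈ a ∷ A × x ∈ r ∷ R × (∀ {u z} → u ∈ a ∷ A → z ∈ r ∷ R → w b x ≤ w u z))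
    nearest a A r R with minimiser (uncurry w) (a , r) (cartesianProduct (a ∷ A) (r ∷ R))
    ... | (b , x) , mem , least =
      b , x , proj₁ (ends mem) , proj₂ (ends mem) , λ u∈ z∈ → least (there (∈-cartesianProduct⁺ u∈ z∈))
      where
      ends : ∀ {p} → p ∈ (a , r) ∷ cartesianProduct (a ∷ A) (r ∷ R) → proj₁ p ∈ a ∷ A × proj₂ p ∈ r ∷ R
      ends (here refl) = here refl , here refl
      ends (there p∈)  = ∈-cartesianProduct⁻ (a ∷ A) (r ∷ R) p∈

    prim : ∀ k a A R → length R ≡ k → Σ[ R' ∈ List V ] Σ[ gs ∈ List ℚ ] (R' ↭ R × Prim (a ∷ A) R' gs)
    prim zero    a A []      eq = [] , [] , ↭-refl , []
    prim (suc k) a A (r ∷ R) eq with nearest a A r R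
    ... | b , x , b∈ , x∈ , least with ∈-∃++ x∈
    ...   | l , l' , split with prim k x (a ∷ A) (l ++ l')
                                (ℕ.suc-injective (trans (sym (↭-length (shift x l l'))) (trans (cong length (sym split)) eq)))
    ...     | R' , gs , R'↭ , p = x ∷ R' , w b x ∷ gs , perm ,
                                  grow b∈ (λ u∈ z∈ → least u∈ (∈-resp-↭ perm z∈)) p
      where
      perm : x ∷ R' ↭ r ∷ R
      perm = subst (x ∷ R' ↭_) (sym split) (↭-trans (prep x R'↭) (↭-sym (shift x l l')))

    prim-length : ∀ {A R gs} → Prim A R gs → length gs ≡ length R
    prim-length []           = refl
    prim-length (grow _ _ p) = cong suc (prim-length p)

    prim-gap : ∀ {A R gs} → Prim A R gs → ∀ {u z} j (z∈R : z ∈ R) → j ℕ.≤ index z∈R →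
               (u ∈ A ⊎ Σ[ u∈R ∈ u ∈ R ] index u∈R ℕ.< j) → at gs j ≤ w u z
    prim-gap (grow _ least _) zero    z∈          _       (inj₁ u∈)               = least u∈ z∈
    prim-gap (grow _ _ p)     (suc j) (there z∈) (s≤s q) (inj₁ u∈)               = prim-gap p j z∈ q (inj₁ (there u∈))
    prim-gap (grow _ _ p)     (suc j) (there z∈) (s≤s q) (inj₂ (here refl , _))  = prim-gap p j z∈ q (inj₁ (here refl))
    prim-gap (grow _ _ p)     (suc j) (there z∈) (s≤s q) (inj₂ (there u∈ , s≤s r)) = prim-gap p j z∈ q (inj₂ (u∈ , r))

    prim-gaps : ∀ {P : ℚ → Set} → (∀ a x → P (w a x)) → ∀ {A R gs} → Prim A R gs → All P gs
    prim-gaps f []                   = []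
    prim-gaps f (grow {a} {x} _ _ p) = f a x ∷ prim-gaps f p

    attachments : ∀ {A R gs} → Prim A R gs → List (V × V × ℚ)
    attachments []                   = []
    attachments (grow {a} {x} _ _ p) = (a , x , w a x) ∷ attachments p

    attachments-total : ∀ {A R gs} (p : Prim A R gs) → total (attachments p) ≡ sumBy id gs
    attachments-total []                   = refl
    attachments-total (grow {a} {x} _ _ p) = cong (w a x +_) (attachments-total p)

    attachments-weights : ∀ {A R gs} (p : Prim A R gs) → All (λ (a , b , r) → r ≡ w a b) (attachments p)
    attachments-weights []           = []
    attachments-weights (grow _ _ p) = refl ∷ attachments-weights p

    attachments-connect : ∀ {A R gs} (p : Prim A R gs) {o : V} {B : Set} (c : V → B) →
      All (λ (a , b , _) → c a ≡ c b) (attachments p) →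
      (∀ {z} → z ∈ A → c z ≡ c o) → ∀ {z} → z ∈ R → c z ≡ c o
    attachments-connect (grow a∈ _ p) c (ax ∷ js) f (here refl) = trans (sym ax) (f a∈)
    attachments-connect (grow {a} {x} a∈ _ p) {o} c (ax ∷ js) f (there z∈)  =
      attachments-connect p c js (λ { (here refl) → trans (sym ax) (f a∈) ; (there q) → f q }) z∈

    walk : V → List V → ℚ
    walk h []      = 0ℚ
    walk h (y ∷ l) = w h y + walk y l

    walk-nonneg : ∀ h l → 0ℚ ≤ walk h l
    walk-nonneg h []      = ℚ.≤-refl
    walk-nonneg h (y ∷ l) = ℚ.+-mono-≤ (w-nonneg h y) (walk-nonneg y l)

    walk-start : ∀ x y l → walk x l ≤ w x y + walk y l
    walk-start x y []      = ℚ.+-mono-≤ (w-nonneg x y) ℚ.≤-refl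
    walk-start x y (z ∷ l) = ≤-resp refl (sym (ℚ.+-assoc (w x y) (w y z) (walk z l)))
                               (ℚ.+-monoˡ-≤ (walk z l) (w-tri x y z))

    walk-filter : ∀ {P : V → Set} (P? : Decidable P) h l → walk h (filter P? l) ≤ walk h l
    walk-filter P? h []      = ℚ.≤-refl
    walk-filter P? h (y ∷ l) with P? y
    ... | yes _ = ℚ.+-monoʳ-≤ (w h y) (walk-filter P? y l)
    ... | no _  = ℚ.≤-trans (walk-filter P? h l) (walk-start h y l)

    walk-far : ∀ h l {z} → z ∈ l → w h z ≤ walk h l
    walk-far h (y ∷ l) (here refl) = ≤-resp (sym (ℚ.+-identityʳ (w h y))) refl
                                       (ℚ.+-monoʳ-≤ (w h y) (walk-nonneg y l))
    walk-far h (y ∷ l) {z} (there z∈) = ℚ.≤-trans (w-tri h y z) (ℚ.+-monoʳ-≤ (w h y) (walk-far y l z∈))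

    walk-diameter : ∀ h l {u z} → u ∈ h ∷ l → z ∈ h ∷ l → u ≢ z → w u z ≤ walk h l
    walk-diameter h l       (here refl) (here refl) u≢z = contradiction refl u≢z
    walk-diameter h l       (here refl) (there z∈)  _   = walk-far h l z∈
    walk-diameter h l {u}   (there u∈)  (here refl) _   = ≤-resp (w-sym u h) refl (walk-far h l u∈)
    walk-diameter h (y ∷ l) (there u∈)  (there z∈)  u≢z =
      ℚ.≤-trans (walk-diameter y l u∈ z∈ u≢z) (p≤q+p (w-nonneg h y))

    detour : ∀ h l {a} v → a ∈ h ∷ l → Σ[ l' ∈ List V ]
             (walk h l' ≤ walk h l + (w a v + w a v) × v ∈ l' × (∀ {z} → z ∈ l → z ∈ l'))
    detour h []      v (here refl) = v ∷ [] , bound , here refl , λ ()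
      where
      bound : w h v + 0ℚ ≤ 0ℚ + (w h v + w h v)
      bound = ≤-resp (ℚ.+-identityʳ _) (ℚ.+-identityˡ _) (p≤q+p (w-nonneg h v))
    detour h (y ∷ l) v (here refl) = v ∷ y ∷ l , bound , here refl , there
      where
      open ℚ.≤-Reasoning
      bound : w h v + (w v y + walk y l) ≤ (w h y + walk y l) + (w h v + w h v)
      bound = begin
        w h v + (w v y + walk y l)            ≤⟨ ℚ.+-monoʳ-≤ (w h v) (ℚ.+-monoˡ-≤ (walk y l) (w-tri v h y)) ⟩
        w h v + ((w v h + w h y) + walk y l)  ≡⟨ cong (λ q → w h v + ((q + w h y) + walk y l)) (w-sym v h) ⟩
        w h v + ((w h v + w h y) + walk y l)  ≡⟨ detour-sum (w h v) (w h y) (walk y l) ⟩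
        (w h y + walk y l) + (w h v + w h v)  ∎
    detour h (y ∷ l) {a} v (there a∈) with detour y l v a∈
    ... | l' , bound , v∈ , ⊆ = y ∷ l' ,
      ≤-resp refl (ℚ.+-assoc (w h y) (walk y l) (w a v + w a v)) (ℚ.+-monoʳ-≤ (w h y) bound) ,
      there v∈ , λ { (here refl) → here refl ; (there z∈) → there (⊆ z∈) }

    prim-tour : ∀ {A R gs} → Prim A R gs → ∀ h l → (∀ {z} → z ∈ A → z ∈ h ∷ l) → Σ[ l' ∈ List V ]
                (walk h l' ≤ walk h l + (sumBy id gs + sumBy id gs) ×
                 (∀ {z} → z ∈ R → z ∈ h ∷ l') × (∀ {z} → z ∈ h ∷ l → z ∈ h ∷ l'))
    prim-tour []                   h l A⊆ = l , ≤-resp refl (ℚ.+-identityʳ _) ℚ.≤-refl , (λ ()) , id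
    prim-tour (grow {a} {x} {R} {gs} a∈ _ p) h l A⊆ with detour h l x (A⊆ a∈)
    ... | l₁ , b₁ , x∈ , ⊆₁ with prim-tour p h l₁ (λ { (here refl) → there x∈ ; (there q) → grown (A⊆ q) })
      where
      grown : ∀ {z} → z ∈ h ∷ l → z ∈ h ∷ l₁
      grown (here eq)  = here eq
      grown (there z∈) = there (⊆₁ z∈)
    ... | l₂ , b₂ , R⊆ , ⊆₂ = l₂ , bound , (λ { (here refl) → ⊆₂ (there x∈) ; (there q) → R⊆ q }) ,
                              λ { (here eq) → here eq ; (there z∈) → ⊆₂ (there (⊆₁ z∈)) }
      where
      open ℚ.≤-Reasoning
      s = sumBy id gs
      bound : walk h l₂ ≤ walk h l + ((w a x + s) + (w a x + s))
      bound = begin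
        walk h l₂                                     ≤⟨ b₂ ⟩
        walk h l₁ + (s + s)                           ≤⟨ ℚ.+-monoˡ-≤ (s + s) b₁ ⟩
        (walk h l + (w a x + w a x)) + (s + s)        ≡⟨ double-sum (walk h l) (w a x) s ⟩
        walk h l + ((w a x + s) + (w a x + s))        ∎

    legs : V → List V → List (V × V × ℚ)
    legs h []      = []
    legs h (y ∷ l) = (h , y , w h y) ∷ legs y l

    consecutive : List V → List (V × V × ℚ)
    consecutive []      = []
    consecutive (h ∷ l) = legs h l

    legs-total : ∀ h l → total (legs h l) ≡ walk h l
    legs-total h []      = refl
    legs-total h (y ∷ l) = cong (w h y +_) (legs-total y l)

    consecutive-filter : ∀ {P : V → Set} (P? : Decidable P) h l →
                         total (consecutive (filter P? (h ∷ l))) ≤ walk h l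
    consecutive-filter P? h l with P? h
    ... | yes _ = ≤-resp (legs-total h (filter P? l)) refl (walk-filter P? h l)
    consecutive-filter P? h []      | no _ = ℚ.≤-refl
    consecutive-filter P? h (y ∷ l) | no _ = ℚ.≤-trans (consecutive-filter P? y l) (p≤q+p (w-nonneg h y))

    consecutive-all : ∀ {P : V → Set} l → All P l →
                      All (λ (a , b , r) → P a × P b × r ≡ w a b) (consecutive l)
    consecutive-all []          _            = []
    consecutive-all (h ∷ [])    _            = []
    consecutive-all (h ∷ y ∷ l) (p ∷ q ∷ ps) = (p , q , refl) ∷ consecutive-all (y ∷ l) (q ∷ ps)

    legs-connect : ∀ {B : Set} (c : V → B) h l → All (λ (a , b , _) → c a ≡ c b) (legs h l) →
                   ∀ {z} → z ∈ h ∷ l → c z ≡ c h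
    legs-connect c h l       _        (here refl) = refl
    legs-connect c h (y ∷ l) (j ∷ js) (there z∈)  = trans (legs-connect c y l js z∈) (sym j)

    consecutive-connect : ∀ {B : Set} (c : V → B) l → All (λ (a , b , _) → c a ≡ c b) (consecutive l) →
                          ∀ {u z} → u ∈ l → z ∈ l → c u ≡ c z
    consecutive-connect c (h ∷ l) js u∈ z∈ = trans (legs-connect c h l js u∈) (sym (legs-connect c h l js z∈))

module Spanning-Trees where

  open import Data.Fin.Base as Fin using (Fin)
  import Data.Fin.Properties as Fin
  open import Data.List.Base using (List; []; _∷_; _++_; [_]; map; length)
  open import Data.List.Membership.Propositional using (_∈_)
  open import Data.List.Membership.Propositional.Properties using (∈-∃++; ∈-++⁻)
  open import Data.List.Properties using (++-assoc)
  open import Data.List.Relation.Binary.Permutation.Propositional using (_↭_; ↭-sym; ↭⇒↭ₛ)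
  open import Data.List.Relation.Binary.Permutation.Propositional.Properties using (++-comm; ↭-length)
  open import Data.List.Relation.Unary.All as All using (All; []; _∷_)
  open import Data.List.Relation.Unary.AllPairs using (AllPairs; []; _∷_)
  open import Data.List.Relation.Unary.Any as Any using (Any; here; there)
  open import Data.List.Relation.Unary.Linked using (Linked; []; [-]; _∷_)
  open import Data.List.Relation.Unary.Unique.Propositional using (Unique)
  open import Data.Nat.Base as ℕ using (ℕ)
  import Data.Nat.Properties as ℕ
  open import Data.Product.Base using (_×_; _,_; proj₁; proj₂; Σ-syntax; uncurry)
  open import Data.Rational.Base using (ℚ; _+_)
  import Data.Rational.Properties as ℚ
  open import Data.Sum.Base using (_⊎_; inj₁; inj₂)
  open import Function.Base using (id; _∘_)
  open import Relation.Binary.Construct.Closure.ReflexiveTransitive as Star using (Star; ε; _◅_; _◅◅_)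
  open import Relation.Binary.PropositionalEquality using (_≡_; _≢_; refl; sym; trans; cong; subst; setoid; module ≡-Reasoning)
  open import Relation.Binary.Structures using (IsEquivalence)
  open import Relation.Binary.Core using (Rel)
  open import Relation.Nullary.Decidable using (yes; no)
  open import Relation.Nullary.Negation using (¬_; contradiction)
  open import Level using (0ℓ)
  import Data.List.Relation.Binary.Permutation.Setoid.Properties as PermProps
  open Kruskal-Forests
  open Prim-Tours

  linked-split : {A : Set} {R : Rel A 0ℓ} → ∀ l {v l'} → Linked R (l ++ v ∷ l') →
                 Linked R (l ++ [ v ]) × Linked R (v ∷ l')
  linked-split []          lk       = [-] , lk
  linked-split (x ∷ [])    (r ∷ lk) = (r ∷ [-]) , lk
  linked-split (x ∷ y ∷ l) (r ∷ lk) with linked-split (y ∷ l) lk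
  ... | lk₁ , lk₂ = (r ∷ lk₁) , lk₂

  linked-join : {A : Set} {R : Rel A 0ℓ} → ∀ l {v l'} → Linked R (l ++ [ v ]) → Linked R (v ∷ l') →
                Linked R (l ++ v ∷ l')
  linked-join []          _        lk' = lk'
  linked-join (x ∷ [])    (r ∷ lk) lk' = r ∷ lk'
  linked-join (x ∷ y ∷ l) (r ∷ lk) lk' = r ∷ linked-join (y ∷ l) lk lk'

  rotate : {A : Set} {R : Rel A 0ℓ} → ∀ {x l v} → v ∈ x ∷ l → Unique (x ∷ l) → Linked R (x ∷ l ++ [ x ]) →
           Σ[ l' ∈ List A ] (length l' ≡ length l × Unique (v ∷ l') × Linked R (v ∷ l' ++ [ v ]))
  rotate {l = l}         (here refl) un lk = l , refl , un , lk
  rotate {A} {R} {x} {l} {v} (there v∈)  un lk with ∈-∃++ v∈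
  ... | l₁ , l₂ , refl = l₂ ++ x ∷ l₁ , ℕ.suc-injective (↭-length (↭-sym perm)) ,
                         PermProps.Unique-resp-↭ (setoid A) (↭⇒↭ₛ perm) un , rotated
    where
    perm : x ∷ l₁ ++ v ∷ l₂ ↭ v ∷ l₂ ++ x ∷ l₁
    perm = ++-comm (x ∷ l₁) (v ∷ l₂)
    halves : Linked R (x ∷ l₁ ++ [ v ]) × Linked R (v ∷ l₂ ++ [ x ])
    halves = linked-split (x ∷ l₁) (subst (λ l → Linked R (x ∷ l)) (++-assoc l₁ (v ∷ l₂) [ x ]) lk)
    rotated : Linked R (v ∷ (l₂ ++ x ∷ l₁) ++ [ v ])
    rotated = subst (λ l → Linked R (v ∷ l)) (sym (++-assoc l₂ (x ∷ l₁) [ v ]))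
                (linked-join (v ∷ l₂) (proj₂ halves) (proj₁ halves))

  module _ {n : ℕ} where

    open Labellings (Fin._≟_ {n})

    SameEdge-sym : ∀ {a b : Fin n} {f} → SameEdge (a , b) f → SameEdge (b , a) f
    SameEdge-sym (inj₁ (p , q)) = inj₂ (q , p)
    SameEdge-sym (inj₂ (p , q)) = inj₁ (q , p)

    Adjacent-sym : ∀ {F : List (Edge n)} {a b} → Adjacent F a b → Adjacent F b a
    Adjacent-sym = Any.map SameEdge-sym

    Reach-isEquivalence : (F : List (Edge n)) → IsEquivalence (Star (Adjacent F))
    Reach-isEquivalence F = record { refl = ε ; sym = Star.reverse Adjacent-sym ; trans = _◅◅_ }

    data Forest : (Fin n → Fin n) → List (Edge n) → Set where
      []  : Forest id []
      add : ∀ {c F a b} → c a ≢ c b → Forest c F → Forest (merge c a b) ((a , b) ∷ F)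

    joins-adjacent : ∀ {A : Set} (c : Fin n → A) {F a b} → All (λ (u , v) → c u ≡ c v) F → Adjacent F a b → c a ≡ c b
    joins-adjacent c (p ∷ _)  (here (inj₁ (refl , refl))) = p
    joins-adjacent c (p ∷ _)  (here (inj₂ (refl , refl))) = sym p
    joins-adjacent c (_ ∷ ps) (there adj)                 = joins-adjacent c ps adj

    joins-reach : ∀ {A : Set} (c : Fin n → A) {F a b} → All (λ (u , v) → c u ≡ c v) F → Star (Adjacent F) a b → c a ≡ c b
    joins-reach c js ε          = refl
    joins-reach c js (adj ◅ st) = trans (joins-adjacent c js adj) (joins-reach c js st)

    forest-joins : ∀ {c F} → Forest c F → All (λ (u , v) → c u ≡ c v) F
    forest-joins []                          = []
    forest-joins (add {c} {F} {a} {b} _ fo) = merge-joins c a b ∷ All.map (merge-mono c a b) (forest-joins fo)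

    forest-reach : ∀ {c F} → Forest c F → c ⊑ Star (Adjacent F)
    forest-reach []                          refl = ε
    forest-reach (add {c} {F} {a} {b} _ fo) =
      merge-least (Reach-isEquivalence ((a , b) ∷ F)) c a b
        (λ p → Star.map there (forest-reach fo p)) (here (inj₁ (refl , refl)) ◅ ε)

    forest-loopless : ∀ {c F} → Forest c F → All (uncurry _≢_) F
    forest-loopless []                 = []
    forest-loopless (add {c} a≁b fo) = a≁b ∘ cong c ∷ forest-loopless fo

    forest-distinct : ∀ {c F} → Forest c F → AllPairs (λ e f → ¬ SameEdge e f) F
    forest-distinct []                          = []
    forest-distinct (add {c} {F} {a} {b} a≁b fo) =
      All.map other (forest-joins fo) ∷ forest-distinct fo
      where
      other : ∀ {f : Edge n} → c (proj₁ f) ≡ c (proj₂ f) → ¬ SameEdge (a , b) f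
      other joined (inj₁ (refl , refl)) = a≁b joined
      other joined (inj₂ (refl , refl)) = a≁b (sym joined)

    -- Follow a cycle from its vertex b, where {a , b} is the edge added last: the
    -- other vertices avoid b, so only the first and the last step can use that edge.
    module _ {c : Fin n → Fin n} {F : List (Edge n)} {a b : Fin n} (joined : All (λ (u , v) → c u ≡ c v) F) where

      stay : ∀ {x y} → x ≢ b → y ≢ b → Adjacent ((a , b) ∷ F) x y → Adjacent F x y
      stay x≢b y≢b (here (inj₁ (_ , y≡b))) = contradiction y≡b y≢b
      stay x≢b y≢b (here (inj₂ (x≡b , _))) = contradiction x≡b x≢b
      stay x≢b y≢b (there adj)             = adj

      back : ∀ y l → All (_≢ b) (y ∷ l) → Linked (Adjacent ((a , b) ∷ F)) (y ∷ l ++ [ b ]) →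
             Σ[ z ∈ Fin n ] (((l ≡ [] × z ≡ y) ⊎ z ∈ l) × c y ≡ c z × z ≢ b × Adjacent ((a , b) ∷ F) z b ×
                             (Adjacent F z b → Linked (Adjacent F) (y ∷ l ++ [ b ])))
      back y []      (y≢b ∷ _)           (adj ∷ [-]) = y , inj₁ (refl , refl) , refl , y≢b , adj , λ adj' → adj' ∷ [-]
      back y (x ∷ l) (y≢b ∷ x≢b ∷ avoid) (adj ∷ lk) with back x l (x≢b ∷ avoid) lk
      ... | z , z∈ , x~z , z≢b , adj' , lift =
        z , inj₂ (mem z∈) , trans (joins-adjacent c joined (stay y≢b x≢b adj)) x~z , z≢b , adj' ,
        λ adj″ → stay y≢b x≢b adj ∷ lift adj″
        where
        mem : (l ≡ [] × z ≡ x) ⊎ z ∈ l → z ∈ x ∷ l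
        mem (inj₁ (_ , z≡x)) = here z≡x
        mem (inj₂ z∈l)       = there z∈l

      avoiding : ∀ l → All (_≢ b) l → Linked (Adjacent ((a , b) ∷ F)) l → Linked (Adjacent F) l
      avoiding []          _                  _          = []
      avoiding (x ∷ [])    _                  _          = [-]
      avoiding (x ∷ y ∷ l) (x≢b ∷ y≢b ∷ avoid) (adj ∷ lk) = stay x≢b y≢b adj ∷ avoiding (y ∷ l) (y≢b ∷ avoid) lk

      add-acyclic : c a ≢ c b → Acyclic F → Acyclic ((a , b) ∷ F)
      add-acyclic a≁b acyclic x y z p un lk with Any.any? (b Fin.≟_) (x ∷ y ∷ z ∷ p)
      ... | no b∉ = acyclic x y z p un (avoiding _ (All.tabulate avoid) lk)
        where
        avoid : ∀ {v} → v ∈ (x ∷ y ∷ z ∷ p) ++ [ x ] → v ≢ b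
        avoid v∈ refl with ∈-++⁻ (x ∷ y ∷ z ∷ p) v∈
        ... | inj₁ b∈          = b∉ b∈
        ... | inj₂ (here refl) = b∉ (here refl)
      ... | yes b∈ with rotate b∈ un lk
      ...   | y' ∷ z' ∷ p' , _ , un'@(b∉ ∷ y'∉ ∷ _) , first ∷ lk' with back y' (z' ∷ p') (All.map (_∘ sym) b∉) lk'
      ...     | v , inj₂ v∈ , y'~v , v≢b , last , lift = close first last
        where
        b≁a : c b ≢ c a
        b≁a = a≁b ∘ sym
        close : Adjacent ((a , b) ∷ F) b y' → Adjacent ((a , b) ∷ F) v b → _
        close (here (inj₁ (_ , refl))) _                       = All.head b∉ refl
        close _                        (here (inj₂ (refl , _))) = v≢b refl
        close (here (inj₂ (_ , refl))) (here (inj₁ (refl , _))) = All.lookup y'∉ v∈ refl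
        close (here (inj₂ (_ , refl))) (there vb)              = a≁b (trans y'~v (joins-adjacent c joined vb))
        close (there by)               (here (inj₁ (refl , _))) = b≁a (trans (joins-adjacent c joined by) y'~v)
        close (there by)               (there vb)              = acyclic b y' z' p' un' (by ∷ lift vb)

    forest-acyclic : ∀ {c F} → Forest c F → Acyclic F
    forest-acyclic []            x y z p un (() ∷ _)
    forest-acyclic (add a≁b fo) = add-acyclic (forest-joins fo) a≁b (forest-acyclic fo)

    forest-spanning : ∀ {c F} → Forest c F → (∀ u v → c u ≡ c v) → IsSpanningTree F
    forest-spanning fo conn = record
      { simple    = record { loopless = forest-loopless fo ; distinct = forest-distinct fo }
      ; connected = λ u v → forest-reach fo (conn u v)
      ; acyclic   = forest-acyclic fo
      }

    module _ {E : Set} (src tgt : E → Fin n) (key : E → ℚ) (w : Fin n → Fin n → ℚ) where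

      open Kruskal (Fin._≟_ {n}) src tgt key using (kruskal; cost)

      kruskal-forest : ∀ {c F} → Forest c F → ∀ L → All (λ e → key e ≡ w (src e) (tgt e)) L →
        Σ[ c' ∈ (Fin n → Fin n) ] Σ[ F' ∈ List (Edge n) ]
          (Forest c' F' × c ⊑ Same c' × All (λ e → c' (src e) ≡ c' (tgt e)) L ×
           weight w F' ≡ cost (kruskal c L) + weight w F)
      kruskal-forest {c} {F} fo []      _           = c , F , fo , id , [] , sym (ℚ.+-identityˡ _)
      kruskal-forest {c} {F} fo (e ∷ L) (eq ∷ eqs) with c (src e) Fin.≟ c (tgt e)
      ... | yes p with kruskal-forest fo L eqs
      ...   | c' , F' , fo' , c⊑c' , js , sum = c' , F' , fo' , c⊑c' , c⊑c' p ∷ js , sum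
      kruskal-forest {c} {F} fo (e ∷ L) (eq ∷ eqs) | no ¬p with kruskal-forest (add ¬p fo) L eqs
      ... | c' , F' , fo' , c⊑c' , js , sum =
        c' , F' , fo' , (λ q → c⊑c' (merge-mono c (src e) (tgt e) q)) ,
        c⊑c' (merge-joins c (src e) (tgt e)) ∷ js , trans sum shuffle
        where
        K = cost (kruskal (merge c (src e) (tgt e)) L)
        shuffle : K + (w (src e) (tgt e) + weight w F) ≡ (key e + K) + weight w F
        shuffle = begin
          K + (w (src e) (tgt e) + weight w F)  ≡⟨ cong (λ q → K + (q + weight w F)) (sym eq) ⟩
          K + (key e + weight w F)              ≡⟨ +-leftComm K (key e) (weight w F) ⟩
          key e + (K + weight w F)              ≡⟨ ℚ.+-assoc (key e) K (weight w F) ⟨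
          (key e + K) + weight w F              ∎
          where open ≡-Reasoning

module Stream-Forests where

  open import Data.Fin.Base as Fin using (Fin)
  import Data.Fin.Properties as Fin
  open import Data.List.Base using (List; []; _∷_; [_]; map; length)
  open import Data.List.Membership.Propositional using (_∈_; find)
  open import Data.List.Membership.DecPropositional using () renaming (_∈?_ to member?)
  open import Data.List.Relation.Unary.All as All using (All; []; _∷_)
  import Data.List.Relation.Unary.All.Properties as All
  open import Data.List.Relation.Unary.AllPairs using ([]; _∷_)
  open import Data.List.Relation.Unary.Any as Any using (Any; here; there)
  open import Data.Nat.Base as ℕ using (ℕ; z≤n; s≤s)
  import Data.Nat.Properties as ℕ
  open import Data.Product.Base using (_×_; _,_; proj₁; proj₂)
  open import Data.Rational.Base using (ℚ; 0ℚ; _+_; _≤_)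
  open import Data.Rational.Properties as ℚ using (_≤?_)
  open import Data.Sum.Base using (inj₁; inj₂)
  open import Function.Base using (id)
  open import Function.Metric.Rational using (IsMetric)
  open import Relation.Binary.PropositionalEquality using (_≡_; _≢_; refl; sym; trans; cong)
  open import Relation.Nullary.Decidable using (Dec; yes; no; _×-dec_)
  open import Relation.Nullary.Negation using (contradiction)
  open Kruskal-Forests
  open Prim-Tours
  open Spanning-Trees

  module Streams (k n : ℕ) (⟦_⟧ : Word k n → ℚ) where

    src tgt : Entry k n → Fin n
    src ((u , _) , _) = u
    tgt ((_ , v) , _) = v

    key : Entry k n → ℚ
    key (_ , x) = ⟦ x ⟧

    open Kruskal (Fin._≟_ {n}) src tgt key public

    Inside : List (Fin n) → Entry k n → Set
    Inside S e = src e ∈ S × tgt e ∈ S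

    inside? : ∀ S e → Dec (Inside S e)
    inside? S e = member? Fin._≟_ (src e) S ×-dec member? Fin._≟_ (tgt e) S

    gather : List (Fin n) → List (Entry k n) → List (Entry k n) → List (Entry k n)
    gather S L []      = L
    gather S L (e ∷ σ) with inside? S e
    ... | yes _ = gather S (insert e L) σ
    ... | no _  = gather S L σ

    refine : List (Fin n) → List (Entry k n) → Entry k n → List (Entry k n)
    refine S F e with inside? S e
    ... | yes _ = kruskal id (insert e F)
    ... | no _  = F

    longer : List (Entry k n) → Entry k n → List (Entry k n)
    longer []      e = [ e ]
    longer (f ∷ _) e with key e ≤? key f
    ... | yes _ = [ f ]
    ... | no _  = [ e ]

    longest : List (Entry k n) → List (Entry k n) → List (Entry k n)
    longest M []      = M
    longest M (e ∷ σ) = longest (longer M e) σ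

    gather-sorted : ∀ S {L} σ → Sorted L → Sorted (gather S L σ)
    gather-sorted S []      so = so
    gather-sorted S (e ∷ σ) so with inside? S e
    ... | yes _ = gather-sorted S σ (insert-sorted _ so)
    ... | no _  = gather-sorted S σ so

    gather-all : ∀ {P : Entry k n → Set} S {L} σ → All P L → All (λ e → Inside S e → P e) σ → All P (gather S L σ)
    gather-all S     []      ps []       = ps
    gather-all S {L} (e ∷ σ) ps (q ∷ qs) with inside? S e
    ... | yes i = gather-all S σ (insert-all L (q i) ps) qs
    ... | no _  = gather-all S σ ps qs

    gather-keeps : ∀ {P : Entry k n → Set} S {L} σ → Any P L → Any P (gather S L σ)
    gather-keeps S     []      p = p
    gather-keeps S {L} (e ∷ σ) p with inside? S e
    ... | yes _ = gather-keeps S σ (insert-there L p)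
    ... | no _  = gather-keeps S σ p

    gather-any : ∀ {P : Entry k n → Set} S {L} σ → Any (λ e → Inside S e × P e) σ → Any P (gather S L σ)
    gather-any S {L} (e ∷ σ) p with inside? S e
    gather-any S {L} (e ∷ σ) (here (_ , p)) | yes _ = gather-keeps S σ (insert-here L p)
    gather-any S     (e ∷ σ) (here (i , p)) | no ¬i = contradiction i ¬i
    gather-any S     (e ∷ σ) (there p)      | yes _ = gather-any S σ p
    gather-any S     (e ∷ σ) (there p)      | no _  = gather-any S σ p

    longer-all : ∀ {P : Entry k n → Set} {M e} → All P M → P e → All P (longer M e)
    longer-all         []       p = p ∷ []
    longer-all {M = f ∷ _} {e} (q ∷ _) p with key e ≤? key f
    ... | yes _ = q ∷ []
    ... | no _  = p ∷ []

    longest-all : ∀ {P : Entry k n → Set} {M} σ → All P M → All P σ → All P (longest M σ)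
    longest-all []      ps []       = ps
    longest-all (e ∷ σ) ps (q ∷ qs) = longest-all σ (longer-all ps q) qs

    longer-length : ∀ M e → length (longer M e) ≡ 1
    longer-length []      e = refl
    longer-length (f ∷ _) e with key e ≤? key f
    ... | yes _ = refl
    ... | no _  = refl

    longest-length : ∀ {M} σ → length M ℕ.≤ 1 → length (longest M σ) ℕ.≤ 1
    longest-length         []      p = p
    longest-length {M} (e ∷ σ) p = longest-length σ (ℕ.≤-reflexive (longer-length M e))

    longer-old : ∀ {M e r} → Any (λ f → r ≤ key f) M → length M ℕ.≤ 1 → Any (λ f → r ≤ key f) (longer M e)
    longer-old {f ∷ []} {e} (here p) _ with key e ≤? key f
    ... | yes _ = here p
    ... | no ¬q = here (ℚ.≤-trans p (ℚ.<⇒≤ (ℚ.≰⇒> ¬q)))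
    longer-old {_ ∷ _ ∷ _} _ (s≤s ())

    longer-new : ∀ M e → Any (λ f → key e ≤ key f) (longer M e)
    longer-new []      e = here ℚ.≤-refl
    longer-new (f ∷ _) e with key e ≤? key f
    ... | yes p = here p
    ... | no _  = here ℚ.≤-refl

    longest-old : ∀ {M r} σ → length M ℕ.≤ 1 → Any (λ f → r ≤ key f) M → Any (λ f → r ≤ key f) (longest M σ)
    longest-old         []      _  p = p
    longest-old {M} (e ∷ σ) l≤ p = longest-old σ (ℕ.≤-reflexive (longer-length M e)) (longer-old p l≤)

    longest-max : ∀ {M} σ → All (λ e → Any (λ f → key e ≤ key f) (longest M σ)) σ
    longest-max         []      = []
    longest-max {M} (e ∷ σ) = longest-old σ (ℕ.≤-reflexive (longer-length M e)) (longer-new M e) ∷ longest-max σ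

    module Instance (w : Fin n → Fin n → ℚ) (metric : IsMetric _≡_ w)
                    (σ : List (Entry k n)) (stream : IsMetricStream k n ⟦_⟧ w σ) where

      private
        module M = IsMetric metric
        module S = IsMetricStream stream

      w-nonneg : ∀ x y → 0ℚ ≤ w x y
      w-nonneg x y = M.nonNegative

      w-self : ∀ x → w x x ≡ 0ℚ
      w-self x = M.≈⇒0 refl

      open Space w w-nonneg M.sym M.triangle public

      diam : ℚ
      diam = cost (longest [] σ)

      longest-metric : All (λ e → src e ≢ tgt e × key e ≡ w (src e) (tgt e)) (longest [] σ)
      longest-metric = longest-all σ [] S.correct

      same-weight : ∀ {u v e} → SameEdge (u , v) (proj₁ e) → key e ≡ w (src e) (tgt e) → key e ≡ w u v
      same-weight         (inj₁ (refl , refl)) eq = eq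
      same-weight {u} {v} (inj₂ (refl , refl)) eq = trans eq (M.sym v u)

      single : ∀ {M r} → length M ℕ.≤ 1 → Any (λ f → r ≤ key f) M → r ≤ cost M
      single {f ∷ []}     _        (here p) = ≤-resp refl (ℚ.+-identityʳ _) p
      single {_ ∷ _ ∷ _} (s≤s ()) _

      diam-nonneg : 0ℚ ≤ diam
      diam-nonneg = sum (longest [] σ) longest-metric
        where
        sum : ∀ M → All (λ e → src e ≢ tgt e × key e ≡ w (src e) (tgt e)) M → 0ℚ ≤ cost M
        sum []      _               = ℚ.≤-refl
        sum (e ∷ M) ((_ , eq) ∷ ps) = ℚ.+-mono-≤ (≤-resp refl eq (w-nonneg _ _)) (sum M ps)

      w≤diam : ∀ u v → w u v ≤ diam
      w≤diam u v with u Fin.≟ v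
      ... | yes refl = ≤-resp (w-self u) refl diam-nonneg
      ... | no u≢v with find (S.complete u v u≢v)
      ...   | e , e∈ , same =
        ≤-resp (sym (same-weight {e = e} same (proj₂ (All.lookup S.correct e∈)))) refl
          (single (longest-length σ z≤n) (All.lookup (longest-max σ) e∈))

      diam≤ : ∀ {r} → 0ℚ ≤ r → (∀ u v → u ≢ v → w u v ≤ r) → diam ≤ r
      diam≤ {r} 0≤r f = bound (longest [] σ) (longest-length σ z≤n) longest-metric
        where
        bound : ∀ M → length M ℕ.≤ 1 → All (λ e → src e ≢ tgt e × key e ≡ w (src e) (tgt e)) M → cost M ≤ r
        bound []          _        _                = 0≤r
        bound (e ∷ [])    _        ((ne , eq) ∷ []) = ≤-resp (trans (ℚ.+-identityʳ _) eq) refl (f _ _ ne)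
        bound (_ ∷ _ ∷ _) (s≤s ()) _

      module Sampled (S : List (Fin n)) where

        L : List (Entry k n)
        L = gather S [] σ

        L-sorted : Sorted L
        L-sorted = gather-sorted S σ []

        L-inside : All (λ e → Inside S e) L
        L-inside = gather-all S σ [] (All.map (λ _ → id) S.correct)

        L-keys : All (λ e → key e ≡ w (src e) (tgt e)) L
        L-keys = gather-all S σ [] (All.map (λ p _ → proj₂ p) S.correct)

        L-complete : ∀ {u v} → u ∈ S → v ∈ S → u ≢ v → Any (λ e → SameEdge (u , v) (proj₁ e)) L
        L-complete {u} {v} u∈ v∈ u≢v = gather-any S σ (Any.map (λ {e} same → ends {e} same , same) (S.complete u v u≢v))
          where
          ends : ∀ {e} → SameEdge (u , v) (proj₁ e) → Inside S e
          ends (inj₁ (refl , refl)) = u∈ , v∈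
          ends (inj₂ (refl , refl)) = v∈ , u∈

        L-spans : ∀ {u v} → u ∈ S → v ∈ S → Spans id L u v (w u v)
        L-spans {u} {v} u∈ v∈ c _ joins with u Fin.≟ v
        ... | yes refl = refl
        ... | no u≢v with find (L-complete u∈ v∈ u≢v)
        ...   | e , e∈ , same = orient same (All.lookup joins e∈
                                  (ℚ.≤-reflexive (same-weight {e = e} same (All.lookup L-keys e∈))))
          where
          orient : SameEdge (u , v) (proj₁ e) → c (src e) ≡ c (tgt e) → c u ≡ c v
          orient (inj₁ (refl , refl)) p = p
          orient (inj₂ (refl , refl)) p = sym p

        K : List (Entry k n)
        K = kruskal id L

        K-connects : ∀ {A : Set} (c : Fin n → A) → All (λ e → c (src e) ≡ c (tgt e)) K →
                     ∀ {u v} → u ∈ S → v ∈ S → c u ≡ c v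
        K-connects c joins {u} {v} u∈ v∈ with u Fin.≟ v
        ... | yes refl = refl
        ... | no u≢v with find (L-complete u∈ v∈ u≢v)
        ...   | e , e∈ , same = orient same (All.lookup spanned e∈)
          where
          spanned = kruskal-spans {R = λ x y → c x ≡ c y} (record { refl = refl ; sym = sym ; trans = trans })
                      {id} (cong c) L joins
          orient : SameEdge (u , v) (proj₁ e) → c (src e) ≡ c (tgt e) → c u ≡ c v
          orient (inj₁ (refl , refl)) p = p
          orient (inj₂ (refl , refl)) p = sym p

        K-optimal : ∀ fs → All (λ (a , b , r) → a ∈ S × b ∈ S × r ≡ w a b) fs →
                    (∀ (c : Fin n → Fin n) → All (λ (a , b , _) → c a ≡ c b) fs →
                     ∀ {u v} → u ∈ S → v ∈ S → c u ≡ c v) →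
                    cost K ≤ total fs
        K-optimal fs ends conn =
          kruskal-optimal L fs L-sorted
            (All.map (λ { (a∈ , b∈ , refl) → w-nonneg _ _ , L-spans a∈ b∈ }) ends)
            (λ c joins → All.map (λ (u∈ , v∈) → conn c joins u∈ v∈) L-inside)

        K-nonneg : 0ℚ ≤ cost K
        K-nonneg = sum K (kruskal-all L L-keys)
          where
          sum : ∀ M → All (λ e → key e ≡ w (src e) (tgt e)) M → 0ℚ ≤ cost M
          sum []      _         = ℚ.≤-refl
          sum (e ∷ M) (eq ∷ ps) = ℚ.+-mono-≤ (≤-resp refl eq (w-nonneg _ _)) (sum M ps)

      weighted : List (Edge n) → List (Fin n × Fin n × ℚ)
      weighted = map (λ (u , v) → u , v , w u v)

      weighted-total : ∀ T → total (weighted T) ≡ weight w T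
      weighted-total []            = refl
      weighted-total ((u , v) ∷ T) = cong (w u v +_) (weighted-total T)

      connected-joins : ∀ {A : Set} {T : List (Edge n)} → Connected T → (c : Fin n → A) →
                        All (λ (a , b , _) → c a ≡ c b) (weighted T) → ∀ u v → c u ≡ c v
      connected-joins conn c joins u v = joins-reach c (All.map⁻ joins) (conn u v)

      module Full (m : ℚ) (mst : IsMST w m) (S : List (Fin n)) (all∈ : ∀ v → v ∈ S) where

        open Sampled S
        private module T = IsMST mst

        exact : cost K ≡ m
        exact = ℚ.≤-antisym upper lower
          where
          T = proj₁ T.attained
          upper : cost K ≤ m
          upper = ≤-resp refl (trans (sym (proj₂ (proj₂ T.attained))) (sym (weighted-total T)))
            (K-optimal (weighted T) (All.map⁺ (All.universal (λ _ → all∈ _ , all∈ _ , refl) T))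
              (λ c joins _ _ → connected-joins (IsSpanningTree.connected (proj₁ (proj₂ T.attained))) c joins _ _))
          lower : m ≤ cost K
          lower with kruskal-forest src tgt key w [] L L-keys
          ... | c , F , fo , _ , joins , sum =
            ≤-resp refl (trans (sym (ℚ.+-identityʳ _)) (sym sum))
              (T.minimal F (forest-spanning fo λ u v →
                K-connects c (kruskal-all L joins) (all∈ u) (all∈ v)))

module Sample-Analysis where

  open import Data.Fin.Base as Fin using (Fin; zero; suc)
  import Data.Fin.Properties as Fin
  open import Data.List.Base using (List; []; _∷_; [_]; map; length; filter; allFin; tabulate)
  open import Data.List.Membership.Propositional using (_∈_)
  open import Data.List.Membership.DecPropositional using () renaming (_∈?_ to member?)
  open import Data.List.Membership.Propositional.Properties using (∈-filter⁺; ∈-filter⁻; ∈-allFin)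
  open import Data.List.Properties using (length-tabulate)
  open import Data.List.Relation.Binary.Permutation.Propositional using (_↭_; ↭-sym; prep; ↭⇒↭ₛ)
  open import Data.List.Relation.Binary.Permutation.Propositional.Properties using (∈-resp-↭; ↭-length)
  import Data.List.Relation.Binary.Permutation.Setoid.Properties as PermProps
  open import Data.List.Relation.Unary.All as All using (All; []; _∷_)
  import Data.List.Relation.Unary.All.Properties as All
  open import Data.List.Relation.Unary.AllPairs using ([]; _∷_)
  open import Data.List.Relation.Unary.Any as Any using (Any; here; there)
  open import Data.List.Relation.Unary.Unique.Propositional using (Unique)
  open import Data.List.Relation.Unary.Unique.Propositional.Properties using (allFin⁺)
  open import Data.Nat.Base as ℕ using (ℕ; zero; suc; z≤n; s≤s; NonZero; _/_)
  open import Data.Nat.DivMod using (m*n/n≡m; /-monoˡ-≤; m%n<n; m≡m%n+[m/n]*n; m/n*n≤m)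
  import Data.Nat.Properties as ℕ
  open import Data.Product.Base using (_×_; _,_; proj₁; proj₂; Σ-syntax)
  open import Data.Rational.Base using (ℚ; 0ℚ; _+_; _≤_)
  open import Data.Rational.Properties as ℚ using (_≤?_)
  open import Data.Rational.Solver using (module +-*-Solver)
  open import Data.Sum.Base using (inj₁; inj₂)
  open import Function.Base using (id; _∘_)
  open import Function.Metric.Rational using (IsMetric)
  open import Relation.Binary.PropositionalEquality using (_≡_; refl; sym; trans; cong; subst; setoid; module ≡-Reasoning)
  open import Relation.Nullary.Decidable using (Dec; yes; no)
  open import Relation.Nullary.Negation using (contradiction)
  open Kruskal-Forests
  open Prim-Tours
  open Spanning-Trees
  open Stream-Forests

  sumTo-extend : ∀ {f} → (∀ j → 0ℚ ≤ f j) → ∀ {k l} → k ℕ.≤′ l → sumTo f k ≤ sumTo f l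
  sumTo-extend 0≤f ℕ.≤′-refl         = ℚ.≤-refl
  sumTo-extend 0≤f (ℕ.≤′-step {l} p) = ℚ.≤-trans (sumTo-extend 0≤f p) (p≤q+p (0≤f l))

  sumTo-mono : ∀ {f g} → (∀ j → f j ≤ g j) → ∀ k → sumTo f k ≤ sumTo g k
  sumTo-mono f≤g zero    = ℚ.≤-refl
  sumTo-mono f≤g (suc k) = ℚ.+-mono-≤ (f≤g k) (sumTo-mono f≤g k)

  +-interchange : ∀ a b c d → (a + b) + (c + d) ≡ (a + c) + (b + d)
  +-interchange = solve 4 (λ a b c d → (a :+ b) :+ (c :+ d) := (a :+ c) :+ (b :+ d)) refl
    where open +-*-Solver

  sumTo-+ : ∀ f g k → sumTo (λ j → f j + g j) k ≡ sumTo f k + sumTo g k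
  sumTo-+ f g zero    = refl
  sumTo-+ f g (suc k) = trans (cong (f k + g k +_) (sumTo-+ f g k)) (+-interchange (f k) (g k) _ _)

  sumTo-split : ∀ f x q → sumTo f (q ℕ.+ x) ≡ sumTo (λ a → f (a ℕ.+ x)) q + sumTo f x
  sumTo-split f x zero    = sym (ℚ.+-identityˡ _)
  sumTo-split f x (suc q) = trans (cong (f (q ℕ.+ x) +_) (sumTo-split f x q))
    (sym (ℚ.+-assoc (f (q ℕ.+ x)) (sumTo (λ a → f (a ℕ.+ x)) q) (sumTo f x)))

  sumTo-residues : ∀ f q k → sumTo f (k ℕ.* q) ≡ sumTo (λ a → sumTo (λ j → f (a ℕ.+ j ℕ.* q)) k) q
  sumTo-residues f q zero    = zeros q
    where
    zeros : ∀ k → 0ℚ ≡ sumTo (λ _ → 0ℚ) k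
    zeros zero    = refl
    zeros (suc k) = trans (zeros k) (sym (ℚ.+-identityˡ _))
  sumTo-residues f q (suc k) = begin
    sumTo f (q ℕ.+ k ℕ.* q)                                   ≡⟨ sumTo-split f (k ℕ.* q) q ⟩
    sumTo (λ a → f (a ℕ.+ k ℕ.* q)) q + sumTo f (k ℕ.* q)     ≡⟨ cong (sumTo top q +_) (sumTo-residues f q k) ⟩
    sumTo top q + sumTo below q                               ≡⟨ sumTo-+ top below q ⟨
    sumTo (λ a → sumTo (λ j → f (a ℕ.+ j ℕ.* q)) (suc k)) q   ∎
    where
    open ≡-Reasoning
    top below : ℕ → ℚ
    top a   = f (a ℕ.+ k ℕ.* q)
    below a = sumTo (λ j → f (a ℕ.+ j ℕ.* q)) k

  *≤⇒≤/ : ∀ i x q .{{_ : NonZero q}} → i ℕ.* q ℕ.≤ x → i ℕ.≤ x / q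
  *≤⇒≤/ i x q p = subst (ℕ._≤ x / q) (m*n/n≡m i q) (/-monoˡ-≤ q p)

  ≤/⇒*≤ : ∀ i x q .{{_ : NonZero q}} → i ℕ.≤ x / q → i ℕ.* q ℕ.≤ x
  ≤/⇒*≤ i x q p = ℕ.≤-trans (ℕ.*-monoˡ-≤ q p) (m/n*n≤m x q)

  /≤⇒<* : ∀ i x q .{{_ : NonZero q}} → x / q ℕ.≤ i → x ℕ.< suc i ℕ.* q
  /≤⇒<* i x q p = subst (ℕ._< suc i ℕ.* q) (sym (m≡m%n+[m/n]*n x q)) (ℕ.+-mono-<-≤ (m%n<n x q) (ℕ.*-monoˡ-≤ q p))

  <*⇒/≤ : ∀ i x q .{{_ : NonZero q}} → x ℕ.< suc i ℕ.* q → x / q ℕ.≤ i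
  <*⇒/≤ i x q x< with x / q ℕ.≤? i
  ... | yes p = p
  ... | no ¬p = contradiction (≤/⇒*≤ (suc i) x q (ℕ.≰⇒> ¬p)) (ℕ.<⇒≱ x<)

  index-unique : {V : Set} {l : List V} → Unique l → ∀ {x} (p q : x ∈ l) → index p ≡ index q
  index-unique un        (here _)    (here _)    = refl
  index-unique (x∉ ∷ _)  (here refl) (there q)   = contradiction refl (All.lookup x∉ q)
  index-unique (x∉ ∷ _)  (there p)   (here refl) = contradiction refl (All.lookup x∉ p)
  index-unique (_ ∷ un)  (there p)   (there q)   = cong suc (index-unique un p q)

  index-onto : {V : Set} (l : List V) → ∀ j → j ℕ.< length l → Σ[ x ∈ V ] Σ[ p ∈ x ∈ l ] index p ≡ j
  index-onto (x ∷ l) zero    _       = x , here refl , refl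
  index-onto (x ∷ l) (suc j) (s≤s q) with index-onto l j q
  ... | y , p , eq = y , there p , cong suc eq

  module Analysis (k n' : ℕ) (⟦_⟧ : Word k (suc n') → ℚ)
                  (w : Fin (suc n') → Fin (suc n') → ℚ) (metric : IsMetric _≡_ w)
                  (σ : List (Entry k (suc n'))) (stream : IsMetricStream k (suc n') ⟦_⟧ w σ) where

    n : ℕ
    n = suc n'

    open Streams k n ⟦_⟧
    open Instance w metric σ stream public

    private
      run : Σ[ R ∈ List (Fin n) ] Σ[ gs ∈ List ℚ ] (R ↭ tabulate {n = n'} suc × Prim [ zero ] R gs)
      run = prim n' zero [] (tabulate suc) (length-tabulate suc)

      rest = proj₁ run
      gs = proj₁ (proj₂ run)
      primRun = proj₂ (proj₂ (proj₂ run))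

    order : List (Fin n)
    order = zero ∷ rest

    order↭ : order ↭ allFin n
    order↭ = prep zero (proj₁ (proj₂ (proj₂ run)))

    order-length : length order ≡ n
    order-length = trans (↭-length order↭) (length-tabulate id)

    gs-length : length gs ≡ n'
    gs-length = trans (prim-length primRun) (ℕ.suc-injective order-length)

    ∈order : ∀ v → v ∈ order
    ∈order v = ∈-resp-↭ (↭-sym order↭) (∈-allFin v)

    order-unique : Unique order
    order-unique = PermProps.Unique-resp-↭ (setoid (Fin n)) (↭⇒↭ₛ (↭-sym order↭)) (allFin⁺ n)

    pos : Fin n → ℕ
    pos v = index (∈order v)

    pos-index : ∀ {v} (p : v ∈ order) → pos v ≡ index p
    pos-index {v} p = index-unique order-unique (∈order v) p

    pos< : ∀ v → pos v ℕ.< n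
    pos< v = subst (pos v ℕ.<_) order-length (Fin.toℕ<n (Any.index (∈order v)))

    pos-onto : ∀ j → j ℕ.< n → Σ[ v ∈ Fin n ] pos v ≡ j
    pos-onto j j<n with index-onto order j (subst (j ℕ.<_) (sym order-length) j<n)
    ... | v , p , eq = v , trans (pos-index p) eq

    gap : ℕ → ℚ
    gap = at gs

    primCost : ℚ
    primCost = sumBy id gs

    gap-nonneg : ∀ j → 0ℚ ≤ gap j
    gap-nonneg = at-all {0ℚ ≤_} ℚ.≤-refl gs (prim-gaps w-nonneg primRun)

    gap≤diam : ∀ j → gap j ≤ diam
    gap≤diam = at-all {_≤ diam} diam-nonneg gs (prim-gaps w≤diam primRun)

    gap-cut : ∀ u v j → pos u ℕ.≤ j → j ℕ.< pos v → gap j ≤ w u v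
    gap-cut u v j u≤j j<v = go (∈order u) (∈order v) u≤j j<v
      where
      go : ∀ {u v} (p : u ∈ order) (q : v ∈ order) → index p ℕ.≤ j → j ℕ.< index q → gap j ≤ w u v
      go (here refl) (there q) _   (s≤s j≤) = prim-gap primRun j q j≤ (inj₁ (here refl))
      go (there p)   (there q) p<j (s≤s j≤) = prim-gap primRun j q j≤ (inj₂ (p , p<j))

    gap-crossed : ∀ u v j → Crosses j (pos u) (pos v) → gap j ≤ w u v
    gap-crossed u v j (inj₁ (p , q)) = gap-cut u v j p q
    gap-crossed u v j (inj₂ (p , q)) = ≤-resp refl (IsMetric.sym metric u v) (gap-cut v u j p q)

    module Costs (m : ℚ) (mst : IsMST w m) where

      m≤primCost : m ≤ primCost
      m≤primCost = ≤-resp (sym exact) (sym (attachments-total primRun))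
        (K-optimal (attachments primRun)
          (All.map (λ eq → ∈-allFin _ , ∈-allFin _ , eq) (attachments-weights primRun))
          (λ c joins {u} {v} _ _ → trans (to-zero c joins u) (sym (to-zero c joins v))))
        where
        open Full m mst (allFin n) ∈-allFin
        open Sampled (allFin n)
        to-zero : (c : Fin n → Fin n) → All (λ (a , b , _) → c a ≡ c b) (attachments primRun) → ∀ u → c u ≡ c zero
        to-zero c joins u with ∈order u
        ... | here refl = refl
        ... | there p   = attachments-connect primRun {zero} c joins (λ { (here refl) → refl }) p

      primCost≤m : primCost ≤ m
      primCost≤m = ≤-resp (trans (sym (sumTo-at gs)) (cong (sumTo gap) gs-length))
                     (trans (sym (proj₂ (proj₂ attained))) (sym (edges-total T)))
        (gaps≤connecting n' (edges T) (All.map⁺ (All.universal dominating T)) connecting)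
        where
        open IsMST mst
        open Path gap
        T = proj₁ attained
        edges : List (Edge n) → List (ℕ × ℕ × ℚ)
        edges = map (λ (u , v) → pos u , pos v , w u v)
        edges-total : ∀ T → total (edges T) ≡ weight w T
        edges-total []            = refl
        edges-total ((u , v) ∷ T) = cong (w u v +_) (edges-total T)
        dominating : ∀ ((u , v) : Edge n) → Dominating n' (pos u , pos v , w u v)
        dominating (u , v) = w-nonneg u v , (ℕ.≤-pred (pos< u) , ℕ.≤-pred (pos< v)) , λ j _ → gap-crossed u v j
        connecting : ∀ c → All (λ (a , b , _) → c a ≡ c b) (edges T) → ∀ j → j ℕ.< n' → c j ≡ c (suc j)
        connecting c joins j j<n' with pos-onto j (ℕ.m<n⇒m<1+n j<n') | pos-onto (suc j) (s≤s j<n')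
        ... | u , refl | v , eq = trans
          (joins-reach (c ∘ pos) (All.map⁻ joins) (IsSpanningTree.connected (proj₁ (proj₂ attained)) u v))
          (cong c eq)

      tour : Σ[ l ∈ List (Fin n) ] (walk zero l ≤ m + m × (∀ v → v ∈ zero ∷ l))
      tour with prim-tour primRun zero [] id
      ... | l , bound , R⊆ , A⊆ = l , ℚ.≤-trans (≤-resp refl (sym (ℚ.+-identityˡ _)) bound) (ℚ.+-mono-≤ primCost≤m primCost≤m) ,
                                  λ v → mem (∈order v)
        where
        mem : ∀ {v} → v ∈ order → v ∈ zero ∷ l
        mem (here eq)  = here eq
        mem (there p)  = R⊆ p

      diam≤2m : diam ≤ m + m
      diam≤2m with tour
      ... | l , bound , all∈ = diam≤ (ℚ.≤-trans (walk-nonneg zero l) bound)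
                                 (λ u v u≢v → ℚ.≤-trans (walk-diameter zero l (all∈ u) (all∈ v) u≢v) bound)

      module _ (S : List (Fin n)) where

        open Sampled S

        K≤2m : cost K ≤ m + m
        K≤2m with tour
        ... | l , bound , all∈ = ℚ.≤-trans
          (K-optimal (consecutive visits)
            (consecutive-all visits (All.tabulate (λ v∈ → proj₂ (∈-filter⁻ ∈S? {xs = zero ∷ l} v∈))))
            (λ c joins u∈ v∈ → consecutive-connect c visits joins
                                  (∈-filter⁺ ∈S? (all∈ _) u∈) (∈-filter⁺ ∈S? (all∈ _) v∈)))
          (ℚ.≤-trans (consecutive-filter ∈S? zero l) bound)
          where
          ∈S? : ∀ v → Dec (v ∈ S)
          ∈S? v = member? Fin._≟_ v S
          visits = filter ∈S? (zero ∷ l)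

        module _ (q' : ℕ) where

          q Q : ℕ
          q = suc q'
          Q = q ℕ.+ q

          HitsBlocks : Set
          HitsBlocks = ∀ b → suc b ℕ.* q ℕ.≤ n → Σ[ v ∈ Fin n ] (v ∈ S × b ℕ.* q ℕ.≤ pos v × pos v ℕ.< suc b ℕ.* q)

          module _ (hits : HitsBlocks) where

            -- A window of length Q = 2 q contains an aligned block of length q.
            hits-window : ∀ x → Q ℕ.+ x ℕ.≤ n → Σ[ v ∈ Fin n ] (v ∈ S × x ℕ.≤ pos v × pos v ℕ.< Q ℕ.+ x)
            hits-window x Q+x≤n with hits (suc (x / q)) (ℕ.≤-trans end Q+x≤n)
              where
              end : suc (suc (x / q)) ℕ.* q ℕ.≤ Q ℕ.+ x
              end = subst (ℕ._≤ Q ℕ.+ x) (ℕ.+-assoc q q _) (ℕ.+-monoʳ-≤ Q (m/n*n≤m x q))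
            ... | v , v∈ , lo , hi = v , v∈ , ℕ.≤-trans (ℕ.<⇒≤ (/≤⇒<* (x / q) x q ℕ.≤-refl)) lo ,
                                     ℕ.<-≤-trans hi (subst (ℕ._≤ Q ℕ.+ x) (ℕ.+-assoc q q _) (ℕ.+-monoʳ-≤ Q (m/n*n≤m x q)))

            -- The regions cut out by the gaps a + j Q all contain a sample, so the
            -- forest on the samples connects them.
            module _ (a t : ℕ) (fits : a ℕ.+ suc t ℕ.* Q ℕ.< n') where

              region : ℕ → ℕ
              region x = ((x ℕ.∸ suc a) / Q) ℕ.⊓ t

              open Path (λ i → gap (a ℕ.+ suc i ℕ.* Q))

              regionEdges : List (Entry k n) → List (ℕ × ℕ × ℚ)
              regionEdges = map (λ e → region (pos (src e)) , region (pos (tgt e)) , key e)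

              regionEdges-total : ∀ M → total (regionEdges M) ≡ cost M
              regionEdges-total []      = refl
              regionEdges-total (e ∷ M) = cong (key e +_) (regionEdges-total M)

              low : ∀ u i → i ℕ.< t → region u ℕ.≤ i → u ℕ.≤ a ℕ.+ suc i ℕ.* Q
              low u i i<k r≤i with ℕ.⊓-sel ((u ℕ.∸ suc a) / Q) t
              ... | inj₂ eq = contradiction (ℕ.≤-trans (ℕ.≤-reflexive (sym eq)) r≤i) (ℕ.<⇒≱ i<k)
              ... | inj₁ eq = ℕ.≤-pred (ℕ.≤-trans (s≤s (ℕ.m≤n+m∸n u (suc a)))
                                (ℕ.≤-trans (ℕ.≤-reflexive (sym (ℕ.+-suc (suc a) _)))
                                  (ℕ.+-monoʳ-≤ (suc a) (/≤⇒<* i _ Q (ℕ.≤-trans (ℕ.≤-reflexive (sym eq)) r≤i)))))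

              high : ∀ v i → i ℕ.< region v → a ℕ.+ suc i ℕ.* Q ℕ.< v
              high v i i<r = ℕ.≤-trans (ℕ.+-monoʳ-≤ (suc a) i*Q≤) (ℕ.≤-reflexive (ℕ.m+[n∸m]≡n (ℕ.<⇒≤ suc-a<v)))
                where
                i*Q≤ : suc i ℕ.* Q ℕ.≤ v ℕ.∸ suc a
                i*Q≤ = ≤/⇒*≤ (suc i) _ Q (ℕ.≤-trans i<r (ℕ.m⊓n≤m _ t))
                suc-a<v : suc a ℕ.< v
                suc-a<v = ℕ.m∸n≢0⇒n<m (ℕ.>⇒≢ (ℕ.≤-trans (s≤s z≤n) i*Q≤))

              gaps≤K : sumTo (λ i → gap (a ℕ.+ suc i ℕ.* Q)) t ≤ cost K
              gaps≤K = ≤-resp refl (sym (regionEdges-total K))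
                (gaps≤connecting t (regionEdges K) (All.map⁺ (All.map dominating (kruskal-all L L-keys))) connecting)
                where
                dominating : ∀ {e} → key e ≡ w (src e) (tgt e) →
                             Dominating t (region (pos (src e)) , region (pos (tgt e)) , key e)
                dominating {e} eq = ≤-resp refl eq (w-nonneg _ _) , (ℕ.m⊓n≤n _ t , ℕ.m⊓n≤n _ t) , crossed
                  where
                  crossed : ∀ i → i ℕ.< t → Crosses i (region (pos (src e))) (region (pos (tgt e))) →
                            gap (a ℕ.+ suc i ℕ.* Q) ≤ key e
                  crossed i i<k (inj₁ (p , r)) = ≤-resp refl eq (gap-crossed _ _ _ (inj₁ (low _ i i<k p , high _ i r)))
                  crossed i i<k (inj₂ (p , r)) = ≤-resp refl eq (gap-crossed _ _ _ (inj₂ (low _ i i<k p , high _ i r)))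
                sampled : ∀ i → i ℕ.≤ t → Σ[ v ∈ Fin n ] (v ∈ S × region (pos v) ≡ i)
                sampled i i≤k with hits-window (i ℕ.* Q ℕ.+ suc a) fit
                  where
                  open ℕ.≤-Reasoning
                  fit : Q ℕ.+ (i ℕ.* Q ℕ.+ suc a) ℕ.≤ n
                  fit = begin
                    Q ℕ.+ (i ℕ.* Q ℕ.+ suc a)  ≡⟨ ℕ.+-assoc Q (i ℕ.* Q) (suc a) ⟨
                    suc i ℕ.* Q ℕ.+ suc a      ≡⟨ ℕ.+-comm (suc i ℕ.* Q) (suc a) ⟩
                    suc a ℕ.+ suc i ℕ.* Q      ≤⟨ ℕ.+-monoʳ-≤ (suc a) (ℕ.*-monoˡ-≤ Q (s≤s i≤k)) ⟩
                    suc a ℕ.+ suc t ℕ.* Q      ≤⟨ fits ⟩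
                    n'                         ≤⟨ ℕ.n≤1+n n' ⟩
                    n                          ∎
                ... | v , v∈ , lo , hi = v , v∈ , trans (cong (ℕ._⊓ t) (ℕ.≤-antisym upper lower)) (ℕ.m≤n⇒m⊓n≡m i≤k)
                  where
                  upper : (pos v ℕ.∸ suc a) / Q ℕ.≤ i
                  upper = <*⇒/≤ i _ Q (ℕ.m<n+o⇒m∸n<o (pos v) (suc a) (subst (pos v ℕ.<_)
                            (trans (sym (ℕ.+-assoc Q (i ℕ.* Q) (suc a))) (ℕ.+-comm (suc i ℕ.* Q) (suc a))) hi))
                  lower : i ℕ.≤ (pos v ℕ.∸ suc a) / Q
                  lower = *≤⇒≤/ i _ Q (subst (ℕ._≤ pos v ℕ.∸ suc a) (ℕ.m+n∸n≡m (i ℕ.* Q) (suc a)) (ℕ.∸-monoˡ-≤ (suc a) lo))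
                connecting : ∀ c → All (λ (x , y , _) → c x ≡ c y) (regionEdges K) → ∀ i → i ℕ.< t → c i ≡ c (suc i)
                connecting c joins i i<k with sampled i (ℕ.<⇒≤ i<k) | sampled (suc i) i<k
                ... | u , u∈ , refl | v , v∈ , eq =
                  trans (K-connects (c ∘ region ∘ pos) (All.map⁻ joins) u∈ v∈) (cong c eq)

            residue : ∀ a k → sumTo (λ j → gap (a ℕ.+ j ℕ.* Q)) k ≤ cost K + (diam + diam)
            residue a zero    = ℚ.+-mono-≤ K-nonneg (ℚ.+-mono-≤ diam-nonneg diam-nonneg)
            residue a (suc k) with (a ℕ.+ k ℕ.* Q) ℕ.<? n'
            ... | no ¬fits = ≤-resp
              (trans (cong (_+ sumTo (λ j → gap (a ℕ.+ j ℕ.* Q)) k) beyond) (ℚ.+-identityˡ _)) refl (residue a k)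
              where
              beyond : gap (a ℕ.+ k ℕ.* Q) ≡ 0ℚ
              beyond = at-beyond gs _ (ℕ.≤-trans (ℕ.≤-reflexive gs-length) (ℕ.≮⇒≥ ¬fits))
            residue a (suc zero) | yes _ = ℚ.≤-trans (≤-resp (ℚ.+-identityʳ (gap (a ℕ.+ 0))) refl (gap≤diam (a ℕ.+ 0)))
              (ℚ.≤-trans (p≤q+p diam-nonneg) (p≤q+p K-nonneg))
            residue a (suc (suc k)) | yes fits = begin
              f (suc k) + sumTo f (suc k)            ≡⟨ cong (f (suc k) +_) (sumTo-head f k) ⟩
              f (suc k) + (f 0 + sumTo (f ∘ suc) k)  ≤⟨ ℚ.+-mono-≤ (gap≤diam _) (ℚ.+-mono-≤ (gap≤diam _) (gaps≤K a k fits)) ⟩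
              diam + (diam + cost K)                 ≡⟨ ℚ.+-assoc diam diam (cost K) ⟨
              (diam + diam) + cost K                 ≡⟨ ℚ.+-comm (diam + diam) (cost K) ⟩
              cost K + (diam + diam)                 ∎
              where
              open ℚ.≤-Reasoning
              f : ℕ → ℚ
              f j = gap (a ℕ.+ j ℕ.* Q)

            m≤samples : m ≤ sumTo (λ _ → cost K + (diam + diam)) Q
            m≤samples = begin
              m                            ≤⟨ m≤primCost ⟩
              primCost                     ≡⟨ sumTo-at gs ⟨
              sumTo gap (length gs)        ≤⟨ sumTo-extend gap-nonneg (ℕ.≤⇒≤′ len≤) ⟩
              sumTo gap (n ℕ.* Q)          ≡⟨ sumTo-residues gap Q n ⟩
              sumTo (λ a → sumTo (λ j → gap (a ℕ.+ j ℕ.* Q)) n) Q  ≤⟨ sumTo-mono (λ a → residue a n) Q ⟩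
              sumTo (λ _ → cost K + (diam + diam)) Q  ∎
              where
              open ℚ.≤-Reasoning
              len≤ : length gs ℕ.≤ n ℕ.* Q
              len≤ = ℕ.≤-trans (ℕ.≤-reflexive gs-length) (ℕ.≤-trans (ℕ.n≤1+n n') (ℕ.m≤m*n n Q))

module Counting where

  open import Data.Fin.Base using (Fin; zero; suc)
  open import Data.List.Base using (List; []; _∷_; _++_; map; length; filter; allFin; lookup; cartesianProductWith)
  open import Data.List.Membership.Propositional using (_∈_)
  open import Data.List.Properties using (length-tabulate; length-map; length-++; length-filter; filter-++; filter-none; map-tabulate; tabulate-lookup)
  open import Data.List.Relation.Unary.All as All using (All; []; _∷_)
  open import Data.List.Relation.Unary.Any as Any using (Any; here; there)
  open import Data.Nat.Base using (ℕ; zero; suc; z≤n; s≤s; _+_; _*_; _^_; _∸_; _≤_; _<_)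
  open import Data.Nat.Logarithm using (⌊log₂⌋-mono-≤; ⌊log₂[2^n]⌋≡n)
  open import Data.Nat.Properties
  open import Data.Nat.Solver using (module +-*-Solver)
  open import Data.Product.Base using (_×_; _,_; proj₁; proj₂)
  open import Data.Sum.Base using (_⊎_; inj₁; inj₂)
  open import Data.Unit.Base using (tt)
  open import Data.Vec.Base using (Vec; []; _∷_; toList)
  open import Function.Base using (id; _∘_)
  open import Relation.Binary.PropositionalEquality using (_≡_; refl; sym; trans; cong; cong₂; subst)
  open import Relation.Nullary.Decidable using (yes; no; ¬?; _×-dec_)
  open import Relation.Nullary.Negation using (¬_; contradiction)
  open import Relation.Unary using (Decidable)
  open Prim-Tours using (index)

  n<2^lg : ∀ n → n < 2 ^ lg n
  n<2^lg n = ≰⇒> λ 2^lg≤n → 1+n≰n (≤-trans (≤-reflexive (sym (⌊log₂[2^n]⌋≡n (lg n)))) (⌊log₂⌋-mono-≤ 2^lg≤n))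

  bernoulli : ∀ x q t → x ^ t * (x + t * q) ≤ x * (x + q) ^ t
  bernoulli x q zero    = ≤-reflexive (solve 1 (λ x → con 1 :* (x :+ con 0) := x :* con 1) refl x)
    where open +-*-Solver
  bernoulli x q (suc t) = begin
    (x * x ^ t) * (x + (q + t * q))
      ≤⟨ m≤m+n _ (x ^ t * (t * q * q)) ⟩
    (x * x ^ t) * (x + (q + t * q)) + x ^ t * (t * q * q)
      ≡⟨ solve 4 (λ x q t p → (x :* p) :* (x :+ (q :+ t :* q)) :+ p :* (t :* q :* q) := (x :+ q) :* (p :* (x :+ t :* q))) refl x q t (x ^ t) ⟩
    (x + q) * (x ^ t * (x + t * q))
      ≤⟨ *-monoʳ-≤ (x + q) (bernoulli x q t) ⟩
    (x + q) * (x * (x + q) ^ t)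
      ≡⟨ solve 3 (λ x q p → (x :+ q) :* (x :* p) := x :* ((x :+ q) :* p)) refl x q ((x + q) ^ t) ⟩
    x * ((x + q) * (x + q) ^ t) ∎
    where
    open ≤-Reasoning
    open +-*-Solver

  halving : ∀ x q t → x + q ≤ suc t * q → x ^ suc t * 2 ≤ (x + q) ^ suc t
  halving zero      q t _  = z≤n
  halving x@(suc _) q t le = *-cancelˡ-≤ x (begin
    x * (x ^ suc t * 2)          ≡⟨ solve 2 (λ x p → x :* (p :* con 2) := p :* (x :+ x)) refl x (x ^ suc t) ⟩
    x ^ suc t * (x + x)          ≤⟨ *-monoʳ-≤ (x ^ suc t) (+-monoʳ-≤ x (≤-trans (m≤m+n x q) le)) ⟩
    x ^ suc t * (x + suc t * q)  ≤⟨ bernoulli x q (suc t) ⟩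
    x * (x + q) ^ suc t          ∎)
    where
    open ≤-Reasoning
    open +-*-Solver

  ^-distrib-* : ∀ a b e → (a * b) ^ e ≡ a ^ e * b ^ e
  ^-distrib-* a b zero    = refl
  ^-distrib-* a b (suc e) = trans (cong (a * b *_) (^-distrib-* a b e))
    (solve 4 (λ a b p r → a :* b :* (p :* r) := a :* p :* (b :* r)) refl a b (a ^ e) (b ^ e))
    where open +-*-Solver

  avoidance : ∀ n q t d → q ≤ n → n ≤ suc t * q →
              (n ∸ q) ^ (suc t * (lg n * d)) * n ^ d ≤ n ^ (suc t * (lg n * d))
  avoidance n q t d q≤n n≤ = begin
    x ^ (suc t * e) * n ^ d      ≤⟨ *-monoʳ-≤ (x ^ (suc t * e)) n^d≤ ⟩
    x ^ (suc t * e) * 2 ^ e      ≡⟨ cong (_* 2 ^ e) (^-*-assoc x (suc t) e) ⟨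
    (x ^ suc t) ^ e * 2 ^ e      ≡⟨ ^-distrib-* (x ^ suc t) 2 e ⟨
    (x ^ suc t * 2) ^ e          ≤⟨ ^-monoˡ-≤ e half ⟩
    (n ^ suc t) ^ e              ≡⟨ ^-*-assoc n (suc t) e ⟩
    n ^ (suc t * e)              ∎
    where
    open ≤-Reasoning
    x = n ∸ q
    e = lg n * d
    n^d≤ : n ^ d ≤ 2 ^ e
    n^d≤ = ≤-trans (^-monoˡ-≤ d (<⇒≤ (n<2^lg n))) (≤-reflexive (^-*-assoc 2 (lg n) d))
    half : x ^ suc t * 2 ≤ n ^ suc t
    half = subst (λ y → x ^ suc t * 2 ≤ y ^ suc t) (m∸n+n≡m q≤n)
             (halving x q t (≤-trans (≤-reflexive (m∸n+n≡m q≤n)) n≤))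

  count : {A : Set} {P : A → Set} → Decidable P → List A → ℕ
  count P? xs = length (filter P? xs)

  count-none : {A : Set} {P : A → Set} (P? : Decidable P) → (∀ x → ¬ P x) → ∀ xs → count P? xs ≡ 0
  count-none P? ¬P xs = cong length (filter-none P? (All.universal ¬P xs))

  count-++ : {A : Set} {P : A → Set} (P? : Decidable P) → ∀ xs ys → count P? (xs ++ ys) ≡ count P? xs + count P? ys
  count-++ P? xs ys = trans (cong length (filter-++ P? xs ys)) (length-++ (filter P? xs))

  count-map : {A : Set} {B : Set} (f : B → A) {P : A → Set} (P? : Decidable P) → ∀ xs →
              count P? (map f xs) ≡ count (P? ∘ f) xs
  count-map f P? []       = refl
  count-map f P? (x ∷ xs) with P? (f x)
  ... | yes _ = cong suc (count-map f P? xs)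
  ... | no _  = count-map f P? xs

  count-⊎ : {A : Set} {P R Z : A → Set} (P? : Decidable P) (R? : Decidable R) (Z? : Decidable Z) →
            (∀ {x} → Z x → P x ⊎ R x) → ∀ xs → count Z? xs ≤ count P? xs + count R? xs
  count-⊎ P? R? Z? f []       = z≤n
  count-⊎ P? R? Z? f (x ∷ xs) with Z? x | P? x | R? x
  ... | no _  | no _  | no _  = count-⊎ P? R? Z? f xs
  ... | no _  | no _  | yes _ = ≤-trans (count-⊎ P? R? Z? f xs) (+-monoʳ-≤ (count P? xs) (n≤1+n _))
  ... | no _  | yes _ | no _  = m≤n⇒m≤1+n (count-⊎ P? R? Z? f xs)
  ... | no _  | yes _ | yes _ = m≤n⇒m≤1+n (≤-trans (count-⊎ P? R? Z? f xs) (+-monoʳ-≤ (count P? xs) (n≤1+n _)))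
  ... | yes _ | yes _ | no _  = s≤s (count-⊎ P? R? Z? f xs)
  ... | yes _ | yes _ | yes _ = s≤s (≤-trans (count-⊎ P? R? Z? f xs) (+-monoʳ-≤ (count P? xs) (n≤1+n _)))
  ... | yes _ | no _  | yes _ = ≤-trans (s≤s (count-⊎ P? R? Z? f xs)) (≤-reflexive (sym (+-suc (count P? xs) _)))
  ... | yes z | no ¬p | no ¬r with f z
  ...   | inj₁ p = contradiction p ¬p
  ...   | inj₂ r = contradiction r ¬r

  union-bound : {A : Set} {J : Set} {P : J → A → Set} (P? : ∀ j → Decidable (P j)) (xs : List A) (b : ℕ) (js : List J) →
                All (λ j → count (P? j) xs ≤ b) js →
                count (λ x → Any.any? (λ j → P? j x) js) xs ≤ length js * b
  union-bound P? xs b []       _        = ≤-reflexive (count-none (λ x → Any.any? (λ j → P? j x) []) (λ _ ()) xs)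
  union-bound P? xs b (j ∷ js) (p ∷ ps) = ≤-trans
    (count-⊎ (P? j) (λ x → Any.any? (λ j → P? j x) js) (λ x → Any.any? (λ j → P? j x) (j ∷ js))
             (λ { (here p) → inj₁ p ; (there p) → inj₂ p }) xs)
    (+-mono-≤ p (union-bound P? xs b js ps))

  count-product : {A : Set} {B C : Set} (f : A → B → C) {P : A → Set} {R : B → Set} {Z : C → Set}
                  (P? : Decidable P) (R? : Decidable R) (Z? : Decidable Z) →
                  (∀ {x y} → Z (f x y) → P x × R y) → ∀ xs ys →
                  count Z? (cartesianProductWith f xs ys) ≤ count P? xs * count R? ys
  count-product f P? R? Z? split []       ys = z≤n
  count-product f P? R? Z? split (x ∷ xs) ys with P? x
  ... | yes _ = begin
    count Z? (map (f x) ys ++ cartesianProductWith f xs ys)  ≡⟨ count-++ Z? (map (f x) ys) _ ⟩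
    count Z? (map (f x) ys) + rest                           ≤⟨ +-mono-≤ (row ys) (count-product f P? R? Z? split xs ys) ⟩
    count R? ys + count P? xs * count R? ys                  ∎
    where
    open ≤-Reasoning
    rest = count Z? (cartesianProductWith f xs ys)
    row : ∀ ys → count Z? (map (f x) ys) ≤ count R? ys
    row []       = z≤n
    row (y ∷ ys) with Z? (f x y) | R? y
    ... | yes _ | yes _ = s≤s (row ys)
    ... | yes z | no ¬r = contradiction (proj₂ (split z)) ¬r
    ... | no _  | yes _ = m≤n⇒m≤1+n (row ys)
    ... | no _  | no _  = row ys
  ... | no ¬p = begin
    count Z? (map (f x) ys ++ cartesianProductWith f xs ys)  ≡⟨ skip ys ⟩
    count Z? (cartesianProductWith f xs ys)                  ≤⟨ count-product f P? R? Z? split xs ys ⟩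
    count P? xs * count R? ys                                ∎
    where
    open ≤-Reasoning
    skip : ∀ zs → count Z? (map (f x) zs ++ cartesianProductWith f xs ys) ≡ count Z? (cartesianProductWith f xs ys)
    skip []       = refl
    skip (z ∷ zs) with Z? (f x z)
    ... | yes zz = contradiction (proj₁ (split zz)) ¬p
    ... | no _   = skip zs

  length-product : {A : Set} {B C : Set} (f : A → B → C) → ∀ xs ys →
                   length (cartesianProductWith f xs ys) ≡ length xs * length ys
  length-product f []       ys = refl
  length-product f (x ∷ xs) ys = trans (length-++ (map (f x) ys))
    (cong₂ _+_ (length-map (f x) ys) (length-product f xs ys))

  count-lookup : {A : Set} {P : A → Set} (P? : Decidable P) → ∀ xs → count (P? ∘ lookup xs) (allFin (length xs)) ≡ count P? xs
  count-lookup P? xs = trans (sym (count-map (lookup xs) P? (allFin (length xs))))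
    (cong (count P?) (trans (map-tabulate id (lookup xs)) (tabulate-lookup xs)))

  length-allVecs : ∀ m t → length (allVecs m t) ≡ m ^ t
  length-allVecs m zero    = refl
  length-allVecs m (suc t) = trans (length-product _∷_ (allFin m) (allVecs m t))
    (cong₂ _*_ (length-tabulate {n = m} id) (length-allVecs m t))

  count-allVecs : ∀ {n} {P : Fin n → Set} (P? : Decidable P) s →
                  count (λ v → All.all? P? (toList v)) (allVecs n s) ≤ count P? (allFin n) ^ s
  count-allVecs         P? zero    = ≤-refl
  count-allVecs {n} P? (suc s) = ≤-trans
    (count-product _∷_ P? (λ v → All.all? P? (toList v)) (λ v → All.all? P? (toList v))
      (λ { (p ∷ ps) → p , ps }) (allFin n) (allVecs n s))
    (*-monoʳ-≤ (count P? (allFin n)) (count-allVecs P? s))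

  fails-by-first-coin : ∀ N {m t} {P : Vec (Fin m) (suc t) → Set} (P? : Decidable P)
                        {B : Fin m → Set} (B? : Decidable B) →
                        (∀ {c cs} → ¬ P (c ∷ cs) → B c) →
                        count B? (allFin m) * N ≤ m → FailsAtMost1/ N P?
  fails-by-first-coin N {m} {t} P? B? bad small = begin
    count (λ v → ¬? (P? v)) (allVecs m (suc t)) * N
      ≤⟨ *-monoˡ-≤ N (count-product _∷_ B? (λ _ → yes tt) (λ v → ¬? (P? v)) (λ ¬p → bad ¬p , tt) (allFin m) (allVecs m t)) ⟩
    count B? (allFin m) * count (λ _ → yes tt) (allVecs m t) * N
      ≤⟨ *-monoˡ-≤ N (*-monoʳ-≤ (count B? (allFin m)) (length-filter (λ _ → yes tt) (allVecs m t))) ⟩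
    count B? (allFin m) * length (allVecs m t) * N
      ≡⟨ solve 3 (λ a b c → a :* b :* c := a :* c :* b) refl (count B? (allFin m)) (length (allVecs m t)) N ⟩
    count B? (allFin m) * N * length (allVecs m t)
      ≤⟨ *-monoˡ-≤ (length (allVecs m t)) small ⟩
    m * length (allVecs m t)
      ≡⟨ cong (_* length (allVecs m t)) (length-tabulate {n = m} id) ⟨
    length (allFin m) * length (allVecs m t)
      ≡⟨ length-product _∷_ (allFin m) (allVecs m t) ⟨
    length (allVecs m (suc t)) ∎
    where
    open ≤-Reasoning
    open +-*-Solver

  iota : ℕ → ℕ → List ℕ
  iota b zero    = []
  iota b (suc k) = b ∷ iota (suc b) k

  iota-++ : ∀ b k l → iota b (k + l) ≡ iota b k ++ iota (b + k) l
  iota-++ b zero    l = cong (λ x → iota x l) (sym (+-identityʳ b))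
  iota-++ b (suc k) l = cong (b ∷_) (trans (iota-++ (suc b) k l) (cong (λ x → iota (suc b) k ++ iota x l) (sym (+-suc b k))))

  iota-length : ∀ b k → length (iota b k) ≡ k
  iota-length b zero    = refl
  iota-length b (suc k) = cong suc (iota-length (suc b) k)

  iota-≥ : ∀ b k → All (b ≤_) (iota b k)
  iota-≥ b zero    = []
  iota-≥ b (suc k) = ≤-refl ∷ All.map (≤-trans (n≤1+n b)) (iota-≥ (suc b) k)

  iota-< : ∀ b k → All (_< b + k) (iota b k)
  iota-< b zero    = []
  iota-< b (suc k) = m<m+n b (s≤s z≤n) ∷ All.map (λ p → ≤-trans p (≤-reflexive (sym (+-suc b k)))) (iota-< (suc b) k)

  map-index : ∀ {V : Set} (f : V → ℕ) b l → (∀ {x} (p : x ∈ l) → f x ≡ b + index p) → map f l ≡ iota b (length l)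
  map-index f b []      eq = refl
  map-index f b (x ∷ l) eq = cong₂ _∷_ (trans (eq (here refl)) (+-identityʳ b))
    (map-index f (suc b) l (λ p → trans (eq (there p)) (+-suc b _)))

  Outside : ℕ → ℕ → ℕ → Set
  Outside lo q x = ¬ (lo ≤ x × x < lo + q)

  outside? : ∀ lo q → Decidable (Outside lo q)
  outside? lo q x = ¬? ((lo ≤? x) ×-dec (x <? (lo + q)))

  count-outside : ∀ lo q r → count (outside? lo q) (iota 0 (lo + q + r)) ≤ lo + r
  count-outside lo q r = begin
    count O? (iota 0 (lo + q + r))                                       ≡⟨ cong (count O?) (iota-++ 0 (lo + q) r) ⟩
    count O? (iota 0 (lo + q) ++ iota (lo + q) r)                        ≡⟨ count-++ O? (iota 0 (lo + q)) _ ⟩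
    count O? (iota 0 (lo + q)) + count O? (iota (lo + q) r)              ≤⟨ +-mono-≤ front back ⟩
    lo + r                                                               ∎
    where
    open ≤-Reasoning
    O? = outside? lo q
    inside : filter O? (iota lo q) ≡ []
    inside = filter-none O? (All.zipWith (λ p o → o p) (iota-≥ lo q , iota-< lo q))
    back : count O? (iota (lo + q) r) ≤ r
    back = ≤-trans (length-filter O? (iota (lo + q) r)) (≤-reflexive (iota-length (lo + q) r))
    front : count O? (iota 0 (lo + q)) ≤ lo
    front = begin
      count O? (iota 0 (lo + q))                  ≡⟨ cong (count O?) (iota-++ 0 lo q) ⟩
      count O? (iota 0 lo ++ iota lo q)           ≡⟨ count-++ O? (iota 0 lo) _ ⟩
      count O? (iota 0 lo) + count O? (iota lo q) ≡⟨ cong (λ l → count O? (iota 0 lo) + length l) inside ⟩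
      count O? (iota 0 lo) + 0                    ≡⟨ +-identityʳ _ ⟩
      count O? (iota 0 lo)                        ≤⟨ length-filter O? (iota 0 lo) ⟩
      length (iota 0 lo)                          ≡⟨ iota-length 0 lo ⟩
      lo                                          ∎

  count-outside≤ : ∀ n lo q → lo + q ≤ n → count (outside? lo q) (iota 0 n) ≤ n ∸ q
  count-outside≤ n lo q le = subst (λ n → count (outside? lo q) (iota 0 n) ≤ n ∸ q) (m+[n∸m]≡n le)
    (≤-trans (count-outside lo q r) (≤-reflexive (sym eq)))
    where
    r = n ∸ (lo + q)
    eq : lo + q + r ∸ q ≡ lo + r
    eq = trans (cong (_∸ q) (solve 3 (λ a b c → a :+ b :+ c := a :+ c :+ b) refl lo q r)) (m+n∸n≡m (lo + r) q)
      where open +-*-Solver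

module Encoding where

  open import Data.Fin.Base as Fin using (Fin; toℕ; fromℕ<; inject≤; zero; suc)
  import Data.Fin.Properties as Fin
  open import Data.List.Base using (List; []; _∷_; length)
  open import Data.List.Relation.Unary.All as All using (All; []; _∷_)
  open import Data.List.Relation.Unary.AllPairs using ([])
  open import Data.Nat.Base as ℕ using (ℕ; zero; suc; z≤n; s≤s; NonZero; _+_; _*_; _^_; _≤_; _<_)
  import Data.Nat.Properties as ℕ
  open import Data.Product.Base using (_×_; _,_)
  open import Data.Rational.Base using (ℚ)
  open import Data.Vec.Base as Vec using (Vec; []; _∷_; toList; _++_; take; drop)
  open import Data.Vec.Properties as Vec using (length-toList)
  open import Function.Base using (id)
  open import Relation.Binary.PropositionalEquality using (_≡_; _≢_; refl; sym; trans; cong; cong₂; subst; module ≡-Reasoning)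
  open import Relation.Nullary.Decidable using (yes; no)
  open import Relation.Nullary.Negation using (contradiction)
  open Kruskal-Forests
  open Stream-Forests
  open Counting using (n<2^lg)

  take-++ : {A : Set} → ∀ {m l} (xs : Vec A m) (ys : Vec A l) → take m (xs ++ ys) ≡ xs
  take-++ {m = m} xs ys = Vec.++-injectiveˡ (take m (xs ++ ys)) xs (Vec.take++drop≡id m (xs ++ ys))

  drop-++ : {A : Set} → ∀ {m l} (xs : Vec A m) (ys : Vec A l) → drop m (xs ++ ys) ≡ ys
  drop-++ {m = m} xs ys = Vec.++-injectiveʳ (take m (xs ++ ys)) xs (Vec.take++drop≡id m (xs ++ ys))

  module Machine (k n' : ℕ) .{{_ : NonZero k}} (⟦_⟧ : Word k (suc n') → ℚ) where

    n : ℕ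
    n = suc n'

    W : Set
    W = Word k n

    open Streams k n ⟦_⟧

    n≤words : n ≤ 2 ^ (k * lg n)
    n≤words = ℕ.≤-trans (ℕ.<⇒≤ (n<2^lg n)) (ℕ.^-monoʳ-≤ 2 (ℕ.m≤n*m (lg n) k))

    encV : Fin n → W
    encV u = inject≤ u n≤words

    decV : W → Fin n
    decV x with toℕ x ℕ.<? n
    ... | yes x<n = fromℕ< x<n
    ... | no _    = zero

    decV-encV : ∀ u → decV (encV u) ≡ u
    decV-encV u with toℕ (encV u) ℕ.<? n
    ... | yes p = Fin.toℕ-injective (trans (Fin.toℕ-fromℕ< p) (Fin.toℕ-inject≤ u n≤words))
    ... | no ¬p = contradiction (subst (_< n) (sym (Fin.toℕ-inject≤ u n≤words)) (Fin.toℕ<n u)) ¬p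

    decVs-encVs : ∀ {s} (S : Vec (Fin n) s) → Vec.map decV (Vec.map encV S) ≡ S
    decVs-encVs []      = refl
    decVs-encVs (u ∷ S) = cong₂ _∷_ (decV-encV u) (decVs-encVs S)

    -- Three words per entry; an unused slot holds a loop.
    encL : ∀ c → List (Entry k n) → Vec W (c * 3)
    encL zero    _                   = []
    encL (suc c) []                  = encV zero ∷ encV zero ∷ encV zero ∷ encL c []
    encL (suc c) (((u , v) , x) ∷ l) = encV u ∷ encV v ∷ x ∷ encL c l

    decL : ∀ c → Vec W (c * 3) → List (Entry k n)
    decL zero    _               = []
    decL (suc c) (a ∷ b ∷ x ∷ r) with decV a Fin.≟ decV b
    ... | yes _ = decL c r
    ... | no _  = ((decV a , decV b) , x) ∷ decL c r

    Loopless : List (Entry k n) → Set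
    Loopless = All (λ e → src e ≢ tgt e)

    decL-encL : ∀ c l → length l ≤ c → Loopless l → decL c (encL c l) ≡ l
    decL-encL zero    []                  _       _         = refl
    decL-encL (suc c) []                  _       _         with decV (encV zero) Fin.≟ decV (encV zero)
    ... | yes _ = decL-encL c [] z≤n []
    ... | no ¬p = contradiction refl ¬p
    decL-encL (suc c) (((u , v) , x) ∷ l) (s≤s p) (u≢v ∷ q) with decV (encV u) Fin.≟ decV (encV v)
    ... | yes eq = contradiction (trans (sym (decV-encV u)) (trans eq (decV-encV v))) u≢v
    ... | no _   = cong₂ (λ (a , b) l → ((a , b) , x) ∷ l) (cong₂ _,_ (decV-encV u) (decV-encV v)) (decL-encL c l p q)

    module _ (s : ℕ) where

      Memory : Set
      Memory = Vec (Fin n) s × List (Entry k n) × List (Entry k n)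

      encode : Memory → Vec W (s + (1 * 3 + s * 3))
      encode (S , M , F) = Vec.map encV S ++ (encL 1 M ++ encL s F)

      decode : Vec W (s + (1 * 3 + s * 3)) → Memory
      decode m = Vec.map decV (take s m) , decL 1 (take (1 * 3) (drop s m)) , decL s (drop (1 * 3) (drop s m))

      decode-encode : ∀ S M F → length M ≤ 1 → Loopless M → length F ≤ s → Loopless F →
                      decode (encode (S , M , F)) ≡ (S , M , F)
      decode-encode S M F |M|≤1 llM |F|≤s llF = cong₂ _,_
        (trans (cong (Vec.map decV) (take-++ (Vec.map encV S) slots)) (decVs-encVs S))
        (trans (cong (λ r → decL 1 (take (1 * 3) r) , decL s (drop (1 * 3) r)) (drop-++ (Vec.map encV S) slots))
          (cong₂ _,_ (trans (cong (decL 1) (take-++ (encL 1 M) (encL s F))) (decL-encL 1 M |M|≤1 llM))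
                     (trans (cong (decL s) (drop-++ (encL 1 M) (encL s F))) (decL-encL s F |F|≤s llF))))
        where
        slots = encL 1 M ++ encL s F

      advance : Memory → Entry k n → Memory
      advance (S , M , F) e = S , longer M e , refine (toList S) F e

      module _ (coins : ℕ) (sample : Fin (suc coins) → Vec (Fin n) s) (estimate : ℚ → ℚ → ℚ) where

        algorithm : StreamingAlgorithm W (Entry k n) ℚ
        algorithm = record
          { space  = s + (1 * 3 + s * 3)
          ; coins  = coins
          ; init   = λ c → encode (sample c , [] , [])
          ; step   = λ _ m e → encode (advance (decode m) e)
          ; output = λ m → let (_ , M , F) = decode m in estimate (cost F) (cost M)
          }

        open StreamingAlgorithm algorithm using (process; run; output)

        kruskal-fits : ∀ (S : Vec (Fin n) s) L → All (Inside (toList S)) L → length (kruskal id L) ≤ s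
        kruskal-fits S L ins = subst (length (kruskal id L) ≤_) (length-toList S)
                                 (kruskal-length (toList S) (toList S) id L ins)

        refine-kruskal : ∀ S L e → Sorted L → refine S (kruskal id L) e ≡ kruskal id (gather S L (e ∷ []))
        refine-kruskal S L e so with inside? S e
        ... | yes _ = kruskal-insert id e L so
        ... | no _  = refl

        process-correct : ∀ σ cs S M L → Loopless σ → length M ≤ 1 → Loopless M → Sorted L → All (Inside (toList S)) L →
          process σ cs (encode (S , M , kruskal id L)) ≡
          encode (S , longest M σ , kruskal id (gather (toList S) L σ))
        process-correct []      []       S M L _          _    _   _  _   = refl
        process-correct (e ∷ σ) (c ∷ cs) S M L (ll ∷ lls) |M|≤1 llM so ins = begin
          process σ cs (encode (advance (decode (encode (S , M , kruskal id L))) e))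
            ≡⟨ cong (λ m → process σ cs (encode (advance m e)))
                 (decode-encode S M _ |M|≤1 llM (kruskal-fits S L ins) (kruskal-loopless L)) ⟩
          process σ cs (encode (S , longer M e , refine (toList S) (kruskal id L) e))
            ≡⟨ cong (λ F → process σ cs (encode (S , longer M e , F))) (refine-kruskal (toList S) L e so) ⟩
          process σ cs (encode (S , longer M e , kruskal id L'))
            ≡⟨ process-correct σ cs S (longer M e) L' lls (ℕ.≤-reflexive (longer-length M e)) (longer-all llM ll)
                 (gather-sorted (toList S) (e ∷ []) so) (gather-all (toList S) (e ∷ []) ins (id ∷ [])) ⟩
          encode (S , longest (longer M e) σ , kruskal id (gather (toList S) L' σ))
            ≡⟨ cong (λ L → encode (S , longest (longer M e) σ , kruskal id L)) (gather-cons (toList S) L e σ) ⟩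
          encode (S , longest (longer M e) σ , kruskal id (gather (toList S) L (e ∷ σ))) ∎
          where
          open ≡-Reasoning
          L' = gather (toList S) L (e ∷ [])
          gather-cons : ∀ S L e σ → gather S (gather S L (e ∷ [])) σ ≡ gather S L (e ∷ σ)
          gather-cons S L e σ with inside? S e
          ... | yes _ = refl
          ... | no _  = refl

        run-correct : ∀ σ → Loopless σ → ∀ c cs →
          run σ (c ∷ cs) ≡ estimate (cost (kruskal id (gather (toList (sample c)) [] σ))) (cost (longest [] σ))
        run-correct σ ll c cs = trans
          (cong output (process-correct σ cs (sample c) [] [] ll z≤n [] [] []))
          (cong (λ (_ , M , F) → estimate (cost F) (cost M))
            (decode-encode (sample c) (longest [] σ) (kruskal id L) (longest-length σ z≤n) (longest-all σ [] ll)
              (kruskal-fits (sample c) L (gather-all (toList (sample c)) σ [] (All.map (λ _ → id) ll)))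
              (kruskal-loopless L)))
          where
          L = gather (toList (sample c)) [] σ

module Rational-Bounds where

  import Data.Integer.Base as ℤ
  import Data.Integer.Properties as ℤ
  open import Data.Nat.Base as ℕ using (ℕ; zero; suc)
  import Data.Nat.Properties as ℕ
  open import Data.Product.Base using (_×_; _,_; Σ-syntax)
  open import Data.Rational.Base
  open import Data.Rational.Properties
  open import Data.Rational.Unnormalised.Base as ℚᵘ using (ℚᵘ; mkℚᵘ; *≡*; *≤*)
  import Data.Rational.Unnormalised.Properties as ℚᵘ
  open import Data.Rational.Solver using (module +-*-Solver)
  open import Relation.Binary.PropositionalEquality
  open import Relation.Nullary.Decidable using (yes; no)
  open Kruskal-Forests
  open Prim-Tours

  ℕ→ℚᵘ : ∀ n → toℚᵘ (ℕ→ℚ n) ℚᵘ.≃ mkℚᵘ (ℤ.+ n) 0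
  ℕ→ℚᵘ n = toℚᵘ-fromℚᵘ (mkℚᵘ (ℤ.+ n) 0)

  ℕ→ℚ-+ : ∀ a b → ℕ→ℚ (a ℕ.+ b) ≡ ℕ→ℚ a + ℕ→ℚ b
  ℕ→ℚ-+ a b = toℚᵘ-injective (begin-equality
    toℚᵘ (ℕ→ℚ (a ℕ.+ b))                     ≃⟨ ℕ→ℚᵘ (a ℕ.+ b) ⟩
    mkℚᵘ (ℤ.+ (a ℕ.+ b)) 0                   ≃⟨ *≡* (cong (ℤ._* (ℤ.+ 1)) (sym (cong₂ ℤ._+_ (ℤ.*-identityʳ (ℤ.+ a)) (ℤ.*-identityʳ (ℤ.+ b))))) ⟩
    mkℚᵘ (ℤ.+ a) 0 ℚᵘ.+ mkℚᵘ (ℤ.+ b) 0       ≃⟨ ℚᵘ.+-cong (ℕ→ℚᵘ a) (ℕ→ℚᵘ b) ⟨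
    toℚᵘ (ℕ→ℚ a) ℚᵘ.+ toℚᵘ (ℕ→ℚ b)           ≃⟨ toℚᵘ-homo-+ (ℕ→ℚ a) (ℕ→ℚ b) ⟨
    toℚᵘ (ℕ→ℚ a + ℕ→ℚ b)                     ∎)
    where open ℚᵘ.≤-Reasoning

  ℕ→ℚ-* : ∀ a b → ℕ→ℚ (a ℕ.* b) ≡ ℕ→ℚ a * ℕ→ℚ b
  ℕ→ℚ-* a b = toℚᵘ-injective (begin-equality
    toℚᵘ (ℕ→ℚ (a ℕ.* b))                     ≃⟨ ℕ→ℚᵘ (a ℕ.* b) ⟩
    mkℚᵘ (ℤ.+ (a ℕ.* b)) 0                   ≃⟨ *≡* (cong (ℤ._* (ℤ.+ 1)) (ℤ.pos-* a b)) ⟩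
    mkℚᵘ (ℤ.+ a) 0 ℚᵘ.* mkℚᵘ (ℤ.+ b) 0       ≃⟨ ℚᵘ.*-cong (ℕ→ℚᵘ a) (ℕ→ℚᵘ b) ⟨
    toℚᵘ (ℕ→ℚ a) ℚᵘ.* toℚᵘ (ℕ→ℚ b)           ≃⟨ toℚᵘ-homo-* (ℕ→ℚ a) (ℕ→ℚ b) ⟨
    toℚᵘ (ℕ→ℚ a * ℕ→ℚ b)                     ∎)
    where open ℚᵘ.≤-Reasoning

  ℕ→ℚ-nonNeg : ∀ n → NonNegative (ℕ→ℚ n)
  ℕ→ℚ-nonNeg n = normalize-nonNeg n 1

  0≤ℕ→ℚ : ∀ n → 0ℚ ≤ ℕ→ℚ n
  0≤ℕ→ℚ n = nonNegative⁻¹ (ℕ→ℚ n) {{ℕ→ℚ-nonNeg n}}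

  ℕ→ℚ-mono : ∀ {a b} → a ℕ.≤ b → ℕ→ℚ a ≤ ℕ→ℚ b
  ℕ→ℚ-mono {a} {b} a≤b = ≤-resp refl (trans (cong ℕ→ℚ (sym (ℕ.m∸n+n≡m a≤b))) (ℕ→ℚ-+ (b ℕ.∸ a) a)) (p≤q+p (0≤ℕ→ℚ (b ℕ.∸ a)))

  *-monoʳ : ∀ {p q} n → p ≤ q → ℕ→ℚ n * p ≤ ℕ→ℚ n * q
  *-monoʳ n = *-monoˡ-≤-nonNeg (ℕ→ℚ n) {{ℕ→ℚ-nonNeg n}}

  *-monoˡ : ∀ {p q r} → 0ℚ ≤ r → p ≤ q → p * r ≤ q * r
  *-monoˡ {r = r} 0≤r = *-monoʳ-≤-nonNeg r {{nonNegative 0≤r}}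

  sumTo-const : ∀ r k → sumTo (λ _ → r) k ≡ ℕ→ℚ k * r
  sumTo-const r zero    = sym (*-zeroˡ r)
  sumTo-const r (suc k) = begin
    r + sumTo (λ _ → r) k  ≡⟨ cong₂ _+_ (sym (*-identityˡ r)) (sumTo-const r k) ⟩
    1ℚ * r + ℕ→ℚ k * r     ≡⟨ *-distribʳ-+ r 1ℚ (ℕ→ℚ k) ⟨
    (1ℚ + ℕ→ℚ k) * r       ≡⟨ cong (_* r) (ℕ→ℚ-+ 1 k) ⟨
    ℕ→ℚ (suc k) * r        ∎
    where open ≡-Reasoning

  archimedean : ∀ α → Σ[ N ∈ ℕ ] α ≤ ℕ→ℚ N
  archimedean α@record{} = ℤ.∣ ↥ α ∣ , toℚᵘ-cancel-≤ (ℚᵘ.≤-respʳ-≃ (ℚᵘ.≃-sym (ℕ→ℚᵘ ℤ.∣ ↥ α ∣)) (*≤* bound))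
    where
    open ℤ.≤-Reasoning
    bound : ↥ α ℤ.* (ℤ.+ 1) ℤ.≤ (ℤ.+ ℤ.∣ ↥ α ∣) ℤ.* ↧ α
    bound = begin
      ↥ α ℤ.* (ℤ.+ 1)                 ≡⟨ ℤ.*-identityʳ (↥ α) ⟩
      ↥ α                             ≤⟨ i≤∣i∣ (↥ α) ⟩
      ℤ.+ ℤ.∣ ↥ α ∣                   ≤⟨ ℤ.+≤+ (ℕ.m≤m*n ℤ.∣ ↥ α ∣ (↧ₙ α)) ⟩
      ℤ.+ (ℤ.∣ ↥ α ∣ ℕ.* ↧ₙ α)        ≡⟨ ℤ.pos-* ℤ.∣ ↥ α ∣ (↧ₙ α) ⟩
      (ℤ.+ ℤ.∣ ↥ α ∣) ℤ.* ↧ α         ∎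
      where
      i≤∣i∣ : ∀ i → i ℤ.≤ ℤ.+ ℤ.∣ i ∣
      i≤∣i∣ (ℤ.+ n)    = ℤ.≤-refl
      i≤∣i∣ ℤ.-[1+ n ] = ℤ.-≤+

  bracket : ∀ b .{{_ : ℕ.NonZero b}} α → ℕ→ℚ b ≤ α →
            Σ[ q ∈ ℕ ] (ℕ→ℚ (b ℕ.* suc q) ≤ α × α ≤ ℕ→ℚ ((b ℕ.+ b) ℕ.* suc q))
  bracket b α b≤α with archimedean α
  ... | N , α≤N = search N (≤-trans α≤N (ℕ→ℚ-mono (ℕ.≤-trans (ℕ.n≤1+n N) (ℕ.m≤n*m (suc N) b))))
    where
    search : ∀ N → α ≤ ℕ→ℚ (b ℕ.* suc N) →
             Σ[ q ∈ ℕ ] (ℕ→ℚ (b ℕ.* suc q) ≤ α × α ≤ ℕ→ℚ ((b ℕ.+ b) ℕ.* suc q))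
    search zero    α≤ = 0 , ≤-resp (cong ℕ→ℚ (ℕ.*-identityʳ b)) refl b≤α ,
                        ≤-trans α≤ (ℕ→ℚ-mono (ℕ.*-monoˡ-≤ 1 (ℕ.m≤m+n b b)))
    search (suc N) α≤ with ℕ→ℚ (b ℕ.* suc N) ≤? α
    ... | no ≰  = search N (<⇒≤ (≰⇒> ≰))
    ... | yes p = N , p , ≤-trans α≤ (ℕ→ℚ-mono (begin
      b ℕ.* suc (suc N)            ≡⟨ ℕ.*-suc b (suc N) ⟩
      b ℕ.+ b ℕ.* suc N            ≤⟨ ℕ.+-monoˡ-≤ (b ℕ.* suc N) (ℕ.m≤m*n b (suc N)) ⟩
      b ℕ.* suc N ℕ.+ b ℕ.* suc N  ≡⟨ ℕ.*-distribʳ-+ (suc N) b b ⟨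
      (b ℕ.+ b) ℕ.* suc N          ∎))
      where open ℕ.≤-Reasoning

  quarter-sum : ∀ m → (m + m + (m + m)) * (ℤ.+ 1 / 4) ≡ m
  quarter-sum = solve 1 (λ m → (m :+ m :+ (m :+ m)) :* con (ℤ.+ 1 / 4) := m) refl
    where open +-*-Solver

  scale-quarter : ∀ x t → (x + x) * (t + t) ≡ ℕ→ℚ 16 * x * (t * (ℤ.+ 1 / 4))
  scale-quarter = solve 2 (λ x t → (x :+ x) :* (t :+ t) := con (ℕ→ℚ 16) :* x :* (t :* con (ℤ.+ 1 / 4))) refl
    where open +-*-Solver

module Assembly where

  open import Data.Empty using (⊥)
  open import Data.Fin.Base using (Fin; suc)
  import Data.Integer.Base as ℤ
  open import Data.List.Base using (List; _∷_; map; length; allFin; lookup; upTo)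
  open import Data.List.Membership.Propositional using (_∈_; find)
  open import Data.List.Membership.Propositional.Properties using (∈-upTo⁺; ∈-upTo⁻)
  open import Data.List.Properties using (length-upTo)
  open import Data.List.Relation.Binary.Permutation.Propositional using (↭-sym)
  open import Data.List.Relation.Binary.Permutation.Propositional.Properties using (↭-length; filter-↭)
  open import Data.List.Relation.Unary.All as All using (All; _∷_)
  open import Data.List.Relation.Unary.All.Properties using (¬All⇒Any¬)
  open import Data.List.Relation.Unary.Any as Any using (Any)
  open import Data.Nat.Base as ℕ using (ℕ; suc; z≤n; s≤s; NonZero; _^_) renaming (_*_ to _*ℕ_)
  open import Data.Nat.DivMod using (m/n≤m; m/n*n≤m)
  import Data.Nat.Properties as ℕ
  import Data.Nat.Solver as ℕ
  open import Data.Product.Base using (_×_; _,_; proj₁; proj₂; Σ-syntax)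
  open import Data.Rational.Base using (ℚ; 0ℚ; 1ℚ; _+_; _*_; _≤_; _<_; _⊔_; _/_)
  open import Data.Rational.Properties as ℚ using (_≤?_)
  open import Data.Vec.Base as Vec using (Vec; _∷_; toList)
  open import Data.Vec.Membership.Propositional.Properties using (∈-toList⁺; ∈-allFin⁺)
  open import Function.Base using (id)
  open import Function.Metric.Rational using (IsMetric)
  open import Relation.Binary.PropositionalEquality using (_≡_; refl; sym; trans; cong; subst)
  open import Relation.Nullary.Decidable using (Dec; yes; no; decidable-stable; _×-dec_)
  open import Relation.Nullary.Negation using (¬_)
  open import Relation.Unary using (Decidable)
  open Kruskal-Forests
  open Prim-Tours
  open Stream-Forests
  open Sample-Analysis
  open Counting
  open Encoding
  open Rational-Bounds

  ¼ : ℚ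
  ¼ = ℤ.+ 1 / 4

  uncons : {A : Set} (xs : List A) → 0 ℕ.< length xs → Σ[ y ∈ A ] Σ[ ys ∈ List A ] xs ≡ y ∷ ys
  uncons (y ∷ ys) _ = y , ys , refl

  space-bound : ∀ {α M} sp r t h C → 0ℚ ≤ α → 0ℚ ≤ M → sp ℕ.≤ r *ℕ t → r *ℕ h ℕ.≤ C →
                ℕ→ℚ t * α ≤ ℕ→ℚ h * M → ℕ→ℚ sp * α ≤ ℕ→ℚ C * M
  space-bound {α} {M} sp r t h C 0≤α 0≤M sp≤ rh≤ tα≤ = begin
    ℕ→ℚ sp * α              ≤⟨ *-monoˡ 0≤α (ℕ→ℚ-mono sp≤) ⟩
    ℕ→ℚ (r *ℕ t) * α        ≡⟨ cong (_* α) (ℕ→ℚ-* r t) ⟩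
    ℕ→ℚ r * ℕ→ℚ t * α       ≡⟨ ℚ.*-assoc (ℕ→ℚ r) (ℕ→ℚ t) α ⟩
    ℕ→ℚ r * (ℕ→ℚ t * α)     ≤⟨ *-monoʳ r tα≤ ⟩
    ℕ→ℚ r * (ℕ→ℚ h * M)     ≡⟨ ℚ.*-assoc (ℕ→ℚ r) (ℕ→ℚ h) M ⟨
    ℕ→ℚ r * ℕ→ℚ h * M       ≡⟨ cong (_* M) (ℕ→ℚ-* r h) ⟨
    ℕ→ℚ (r *ℕ h) * M        ≤⟨ *-monoˡ 0≤M (ℕ→ℚ-mono rh≤) ⟩
    ℕ→ℚ C * M               ∎
    where open ℚ.≤-Reasoning

  blocks-bound : ∀ {α} n q b .{{_ : NonZero q}} → α ≤ ℕ→ℚ (b *ℕ q) →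
                 ℕ→ℚ (suc (n ℕ./ q)) * α ≤ ℕ→ℚ (suc b) * (ℕ→ℚ n ⊔ α)
  blocks-bound {α} n q b α≤ = begin
    ℕ→ℚ (1 ℕ.+ x) * α                       ≡⟨ cong (_* α) (ℕ→ℚ-+ 1 x) ⟩
    (1ℚ + ℕ→ℚ x) * α                        ≡⟨ ℚ.*-distribʳ-+ α 1ℚ (ℕ→ℚ x) ⟩
    1ℚ * α + ℕ→ℚ x * α                      ≤⟨ ℚ.+-mono-≤ first second ⟩
    1ℚ * M + ℕ→ℚ b * M                      ≡⟨ ℚ.*-distribʳ-+ M 1ℚ (ℕ→ℚ b) ⟨
    (1ℚ + ℕ→ℚ b) * M                        ≡⟨ cong (_* M) (ℕ→ℚ-+ 1 b) ⟨
    ℕ→ℚ (suc b) * M                         ∎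
    where
    open ℚ.≤-Reasoning
    x = n ℕ./ q
    M = ℕ→ℚ n ⊔ α
    first : 1ℚ * α ≤ 1ℚ * M
    first = ≤-resp (ℚ.*-identityˡ α) (ℚ.*-identityˡ M) (ℚ.p≤q⊔p (ℕ→ℚ n) α)
    second : ℕ→ℚ x * α ≤ ℕ→ℚ b * M
    second = begin
      ℕ→ℚ x * α                ≤⟨ *-monoʳ x α≤ ⟩
      ℕ→ℚ x * ℕ→ℚ (b *ℕ q)     ≡⟨ ℕ→ℚ-* x (b *ℕ q) ⟨
      ℕ→ℚ (x *ℕ (b *ℕ q))      ≡⟨ cong ℕ→ℚ (solve 3 (λ x b q → x :* (b :* q) := b :* (x :* q)) refl x b q) ⟩
      ℕ→ℚ (b *ℕ (x *ℕ q))      ≤⟨ ℕ→ℚ-mono (ℕ.*-monoʳ-≤ b (m/n*n≤m n q)) ⟩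
      ℕ→ℚ (b *ℕ n)             ≡⟨ ℕ→ℚ-* b n ⟩
      ℕ→ℚ b * ℕ→ℚ n            ≤⟨ *-monoʳ b (ℚ.p≤p⊔q (ℕ→ℚ n) α) ⟩
      ℕ→ℚ b * M                ∎
      where open ℕ.+-*-Solver

  memory-words : ∀ s → 1 ℕ.≤ s → s ℕ.+ (1 *ℕ 3 ℕ.+ s *ℕ 3) ℕ.≤ 7 *ℕ s
  memory-words s 1≤s = begin
    s ℕ.+ (3 ℕ.+ s *ℕ 3)          ≤⟨ ℕ.+-monoʳ-≤ s (ℕ.+-monoˡ-≤ (s *ℕ 3) (ℕ.*-monoʳ-≤ 3 1≤s)) ⟩
    s ℕ.+ (3 *ℕ s ℕ.+ s *ℕ 3)     ≡⟨ solve 1 (λ s → s :+ (con 3 :* s :+ s :* con 3) := con 7 :* s) refl s ⟩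
    7 *ℕ s                        ∎
    where
    open ℕ.≤-Reasoning
    open ℕ.+-*-Solver

  Solution : (k d n C : ℕ) → ℚ → (Word k n → ℚ) → Set
  Solution k d n C α ⟦_⟧ =
    Σ[ A ∈ StreamingAlgorithm (Word k n) (Entry k n) ℚ ]
      ((ℕ→ℚ (StreamingAlgorithm.space A) * α ≤ ℕ→ℚ C * (ℕ→ℚ n ⊔ α)) ×
       ((w : Fin n → Fin n → ℚ) → IsMetric _≡_ w →
        (σ : List (Entry k n)) → IsMetricStream k n ⟦_⟧ w σ →
        (m : ℚ) → IsMST w m →
        FailsAtMost1/ (n ^ d) (λ r → approximates? α m (StreamingAlgorithm.run A σ r))))

  module _ (k d n' : ℕ) .{{_ : NonZero k}} (⟦_⟧ : Word k (suc n') → ℚ) (α : ℚ) (1<α : 1ℚ < α) (C : ℕ) where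

    private
      n = suc n'
      module Mach = Machine k n' ⟦_⟧

    0≤α : 0ℚ ≤ α
    0≤α = ℚ.≤-trans (0≤ℕ→ℚ 1) (ℚ.<⇒≤ 1<α)

    0≤n⊔α : 0ℚ ≤ ℕ→ℚ n ⊔ α
    0≤n⊔α = ℚ.≤-trans 0≤α (ℚ.p≤q⊔p (ℕ→ℚ n) α)

    loopless : ∀ {w σ} → IsMetricStream k n ⟦_⟧ w σ → Mach.Loopless σ
    loopless stream = All.map proj₁ (IsMetricStream.correct stream)

    exact-solution : ∀ b → 7 *ℕ b ℕ.≤ C → α ≤ ℕ→ℚ b → Solution k d n C α ⟦_⟧
    exact-solution b 7b≤C α≤b = A , space , correct
      where
      sample : Fin 1 → Vec (Fin n) n
      sample _ = Vec.allFin n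
      A = Mach.algorithm n 0 sample (λ Z _ → Z)
      nα≤ : ℕ→ℚ n * α ≤ ℕ→ℚ b * (ℕ→ℚ n ⊔ α)
      nα≤ = ℚ.≤-trans (*-monoʳ n α≤b) (≤-resp (ℚ.*-comm (ℕ→ℚ n) (ℕ→ℚ b)) refl (*-monoʳ b (ℚ.p≤p⊔q (ℕ→ℚ n) α)))
      space : ℕ→ℚ (n ℕ.+ (1 *ℕ 3 ℕ.+ n *ℕ 3)) * α ≤ ℕ→ℚ C * (ℕ→ℚ n ⊔ α)
      space = space-bound (n ℕ.+ (1 *ℕ 3 ℕ.+ n *ℕ 3)) 7 n b C 0≤α 0≤n⊔α (memory-words n (s≤s z≤n)) 7b≤C nα≤
      correct : ∀ w → IsMetric _≡_ w → ∀ σ → IsMetricStream k n ⟦_⟧ w σ → ∀ m → IsMST w m →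
                FailsAtMost1/ (n ^ d) (λ r → approximates? α m (StreamingAlgorithm.run A σ r))
      correct w metric σ stream m mst = 
        fails-by-first-coin (n ^ d) (λ r → approximates? α m (StreamingAlgorithm.run A σ r)) {B = λ _ → ⊥} (λ _ → no id)
          (λ {c} {cs} ¬P → ¬P (subst (Approximates α m)
            (sym (Mach.run-correct n 0 sample (λ Z _ → Z) σ (loopless stream) c cs)) approx))
          z≤n
        where
        open Streams k n ⟦_⟧
        open Instance w metric σ stream
        open Full m mst (toList (Vec.allFin n)) (λ v → ∈-toList⁺ (∈-allFin⁺ v))
        open Sampled (toList (Vec.allFin n))
        Z = cost K
        approx : Approximates α m Z
        approx = ℚ.≤-reflexive exact , ≤-resp (trans (sym exact) (sym (ℚ.*-identityˡ Z))) refl (*-monoˡ K-nonneg (ℚ.<⇒≤ 1<α))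

    module _ (q' : ℕ) (16q≤α : ℕ→ℚ (16 *ℕ suc q') ≤ α) where

      q t s : ℕ
      q = suc q'
      t = n ℕ./ q
      s = suc t *ℕ (lg n *ℕ suc d)

      estimate : ℚ → ℚ → ℚ
      estimate Z L = (Z + L) * ¼

      module _ (w : Fin n → Fin n → ℚ) (metric : IsMetric _≡_ w)
               (σ : List (Entry k n)) (stream : IsMetricStream k n ⟦_⟧ w σ)
               (m : ℚ) (mst : IsMST w m) where

        open Streams k n ⟦_⟧ using (cost)
        open Analysis k n' ⟦_⟧ w metric σ stream hiding (n)
        open Costs m mst hiding (q; Q)

        estimate-correct : ∀ S → HitsBlocks S q' → Approximates α m (estimate (cost (Sampled.K S)) diam)
        estimate-correct S hits = lower , upper
          where
          open ℚ.≤-Reasoning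
          Z = cost (Sampled.K S)
          0≤¼ : 0ℚ ≤ ¼
          0≤¼ = ℚ.nonNegative⁻¹ ¼
          0≤Y : 0ℚ ≤ (Z + diam) * ¼
          0≤Y = ≤-resp (sym (ℚ.*-zeroˡ ¼)) refl (*-monoˡ 0≤¼ (ℚ.+-mono-≤ (Sampled.K-nonneg S) diam-nonneg))
          lower : (Z + diam) * ¼ ≤ m
          lower = ℚ.≤-trans (*-monoˡ 0≤¼ (ℚ.+-mono-≤ (K≤2m S) diam≤2m)) (ℚ.≤-reflexive (quarter-sum m))
          rearrange : Z + (diam + diam) ≤ (Z + diam) + (Z + diam)
          rearrange = ≤-resp (sym (ℚ.+-assoc Z diam diam)) refl
                        (ℚ.+-monoʳ-≤ (Z + diam) (p≤q+p (Sampled.K-nonneg S)))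
          upper : m ≤ α * ((Z + diam) * ¼)
          upper = begin
            m                                               ≤⟨ m≤samples S q' hits ⟩
            sumTo (λ _ → Z + (diam + diam)) (q ℕ.+ q)        ≡⟨ sumTo-const (Z + (diam + diam)) (q ℕ.+ q) ⟩
            ℕ→ℚ (q ℕ.+ q) * (Z + (diam + diam))             ≤⟨ *-monoʳ (q ℕ.+ q) rearrange ⟩
            ℕ→ℚ (q ℕ.+ q) * ((Z + diam) + (Z + diam))       ≡⟨ cong (_* ((Z + diam) + (Z + diam))) (ℕ→ℚ-+ q q) ⟩
            (ℕ→ℚ q + ℕ→ℚ q) * ((Z + diam) + (Z + diam))     ≡⟨ scale-quarter (ℕ→ℚ q) (Z + diam) ⟩
            ℕ→ℚ 16 * ℕ→ℚ q * ((Z + diam) * ¼)               ≡⟨ cong (_* ((Z + diam) * ¼)) (ℕ→ℚ-* 16 q) ⟨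
            ℕ→ℚ (16 *ℕ q) * ((Z + diam) * ¼)                ≤⟨ *-monoˡ 0≤Y 16q≤α ⟩
            α * ((Z + diam) * ¼)                            ∎

        Misses : ℕ → Fin n → Set
        Misses b v = Outside (b *ℕ q) q (pos v)

        misses? : ∀ b → Decidable (Misses b)
        misses? b v = outside? (b *ℕ q) q (pos v)

        MissesBlock : ℕ → Vec (Fin n) s → Set
        MissesBlock b S = All (Misses b) (toList S)

        missesBlock? : ∀ b → Decidable (MissesBlock b)
        missesBlock? b S = All.all? (misses? b) (toList S)

        Bad : Vec (Fin n) s → Set
        Bad S = Any (λ b → MissesBlock b S) (upTo t)

        bad? : Decidable Bad
        bad? S = Any.any? (λ b → missesBlock? b S) (upTo t)

        good-hits : ∀ S → ¬ Bad S → HitsBlocks (toList S) q'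
        good-hits S ¬bad b fits with find (¬All⇒Any¬ (misses? b) (toList S) ¬misses)
          where
          ¬misses : ¬ MissesBlock b S
          ¬misses misses = ¬bad (Any.map (λ { refl → misses }) (∈-upTo⁺ (*≤⇒≤/ (suc b) n q fits)))
        ... | v , v∈ , ¬outside
            with decidable-stable ((b *ℕ q ℕ.≤? pos v) ×-dec (pos v ℕ.<? b *ℕ q ℕ.+ q)) ¬outside
        ...   | lo , hi = v , v∈ , lo , subst (pos v ℕ.<_) (ℕ.+-comm (b *ℕ q) q) hi

        missing-vertices : ∀ b → b ℕ.< t → count (misses? b) (allFin n) ℕ.≤ n ℕ.∸ q
        missing-vertices b b<t = begin
          count (misses? b) (allFin n)        ≡⟨ ↭-length (filter-↭ (misses? b) (↭-sym order↭)) ⟩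
          count (misses? b) order             ≡⟨ count-map pos (outside? (b *ℕ q) q) order ⟨
          count out? (map pos order)          ≡⟨ cong (count out?) (map-index pos 0 order pos-index) ⟩
          count out? (iota 0 (length order))  ≡⟨ cong (λ l → count out? (iota 0 l)) order-length ⟩
          count out? (iota 0 n)               ≤⟨ count-outside≤ n (b *ℕ q) q fits ⟩
          n ℕ.∸ q                             ∎
          where
          open ℕ.≤-Reasoning
          out? = outside? (b *ℕ q) q
          fits : b *ℕ q ℕ.+ q ℕ.≤ n
          fits = subst (ℕ._≤ n) (ℕ.+-comm q (b *ℕ q)) (≤/⇒*≤ (suc b) n q b<t)

        bad-samples : count bad? (allVecs n s) ℕ.≤ t *ℕ (n ℕ.∸ q) ^ s
        bad-samples = subst (λ l → count bad? (allVecs n s) ℕ.≤ l *ℕ (n ℕ.∸ q) ^ s) (length-upTo t)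
          (union-bound missesBlock? (allVecs n s) ((n ℕ.∸ q) ^ s) (upTo t)
            (All.tabulate (λ {b} b∈ → ℕ.≤-trans (count-allVecs (misses? b) s)
              (ℕ.^-monoˡ-≤ s (missing-vertices b (∈-upTo⁻ b∈))))))

        few-bad : count bad? (allVecs n s) *ℕ n ^ d ℕ.≤ length (allVecs n s)
        few-bad with q ℕ.≤? n
        ... | no q≰n = begin
          count bad? (allVecs n s) *ℕ n ^ d      ≤⟨ ℕ.*-monoˡ-≤ (n ^ d) bad-samples ⟩
          t *ℕ (n ℕ.∸ q) ^ s *ℕ n ^ d            ≡⟨ cong (λ t → t *ℕ (n ℕ.∸ q) ^ s *ℕ n ^ d) t≡0 ⟩
          0                                      ≤⟨ z≤n ⟩
          length (allVecs n s)                   ∎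
          where
          open ℕ.≤-Reasoning
          t≡0 : t ≡ 0
          t≡0 = ℕ.n≤0⇒n≡0 (<*⇒/≤ 0 n q (subst (n ℕ.<_) (sym (ℕ.*-identityˡ q)) (ℕ.≰⇒> q≰n)))
        ... | yes q≤n = begin
          count bad? (allVecs n s) *ℕ n ^ d      ≤⟨ ℕ.*-monoˡ-≤ (n ^ d) bad-samples ⟩
          t *ℕ (n ℕ.∸ q) ^ s *ℕ n ^ d            ≤⟨ ℕ.*-monoˡ-≤ (n ^ d) (ℕ.*-monoˡ-≤ ((n ℕ.∸ q) ^ s) (m/n≤m n q)) ⟩
          n *ℕ (n ℕ.∸ q) ^ s *ℕ n ^ d            ≡⟨ solve 3 (λ a b c → a :* b :* c := b :* (a :* c)) refl n ((n ℕ.∸ q) ^ s) (n ^ d) ⟩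
          (n ℕ.∸ q) ^ s *ℕ n ^ suc d             ≤⟨ avoidance n q t (suc d) q≤n (ℕ.<⇒≤ (/≤⇒<* t n q ℕ.≤-refl)) ⟩
          n ^ s                                  ≡⟨ length-allVecs n s ⟨
          length (allVecs n s)                   ∎
          where
          open ℕ.≤-Reasoning
          open ℕ.+-*-Solver

      module _ (S₀ : Vec (Fin n) s) (Ss : List (Vec (Fin n) s)) (enum : allVecs n s ≡ S₀ ∷ Ss) where

        sample : Fin (suc (length Ss)) → Vec (Fin n) s
        sample = lookup (S₀ ∷ Ss)

        sampler : StreamingAlgorithm (Word k n) (Entry k n) ℚ
        sampler = Mach.algorithm s (length Ss) sample estimate

        sampler-space : ∀ b → α ≤ ℕ→ℚ (b *ℕ q) → 7 *ℕ (lg n *ℕ suc d) *ℕ suc b ℕ.≤ C →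
                        ℕ→ℚ (StreamingAlgorithm.space sampler) * α ≤ ℕ→ℚ C * (ℕ→ℚ n ⊔ α)
        sampler-space b α≤bq C-large = space-bound (s ℕ.+ (1 *ℕ 3 ℕ.+ s *ℕ 3)) (7 *ℕ e) (suc t) (suc b) C
          0≤α 0≤n⊔α words C-large (blocks-bound n q b α≤bq)
          where
          e = lg n *ℕ suc d
          words : s ℕ.+ (1 *ℕ 3 ℕ.+ s *ℕ 3) ℕ.≤ 7 *ℕ e *ℕ suc t
          words = ℕ.≤-trans (memory-words s (s≤s z≤n))
            (ℕ.≤-reflexive (trans (cong (7 *ℕ_) (ℕ.*-comm (suc t) e)) (sym (ℕ.*-assoc 7 e (suc t)))))

        sampler-correct : ∀ w → IsMetric _≡_ w → ∀ σ → IsMetricStream k n ⟦_⟧ w σ → ∀ m → IsMST w m →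
                          FailsAtMost1/ (n ^ d) (λ r → approximates? α m (StreamingAlgorithm.run sampler σ r))
        sampler-correct w metric σ stream m mst =
          fails-by-first-coin (n ^ d) (λ r → approximates? α m (StreamingAlgorithm.run sampler σ r))
            {B = λ c → Bad w metric σ stream m mst (sample c)} (λ c → bad?' (sample c)) (λ {c} → fails {c}) few
          where
          bad?' : Decidable (Bad w metric σ stream m mst)
          bad?' = bad? w metric σ stream m mst
          fails : ∀ {c cs} → ¬ Approximates α m (StreamingAlgorithm.run sampler σ (c ∷ cs)) →
                  Bad w metric σ stream m mst (sample c)
          fails {c} {cs} ¬P = decidable-stable (bad?' (sample c)) λ ¬bad → ¬P
            (subst (Approximates α m) (sym (Mach.run-correct s (length Ss) sample estimate σ (loopless stream) c cs))
              (estimate-correct w metric σ stream m mst (toList (sample c))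
                (good-hits w metric σ stream m mst (sample c) ¬bad)))
          few : count (λ c → bad?' (sample c)) (allFin (suc (length Ss))) *ℕ n ^ d ℕ.≤ suc (length Ss)
          few = subst (λ c → c *ℕ n ^ d ℕ.≤ length (S₀ ∷ Ss)) (sym (count-lookup bad?' (S₀ ∷ Ss)))
                  (subst (λ xs → count bad?' xs *ℕ n ^ d ℕ.≤ length xs) enum (few-bad w metric σ stream m mst))

      sampling-solution : ∀ b → α ≤ ℕ→ℚ (b *ℕ q) → 7 *ℕ (lg n *ℕ suc d) *ℕ suc b ℕ.≤ C → Solution k d n C α ⟦_⟧
      sampling-solution b α≤bq C-large = sampler S₀ Ss enum , sampler-space S₀ Ss enum b α≤bq C-large , sampler-correct S₀ Ss enum
        where
        nonempty = uncons (allVecs n s) (subst (0 ℕ.<_) (sym (length-allVecs n s)) (ℕ.m^n>0 n s))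
        S₀   = proj₁ nonempty
        Ss   = proj₁ (proj₂ nonempty)
        enum = proj₂ (proj₂ nonempty)

  constant : ℕ → ℕ
  constant d = 231 *ℕ suc d

  constant-large : ∀ d n → 7 *ℕ (lg n *ℕ suc d) *ℕ 33 ℕ.≤ constant d *ℕ lg n ^ 1
  constant-large d n = ℕ.≤-reflexive
    (solve 2 (λ l e → con 7 :* (l :* e) :* con 33 := con 231 :* e :* (l :* con 1)) refl (lg n) (suc d))
    where open ℕ.+-*-Solver

  constant-exact : ∀ d n → 7 *ℕ 16 ℕ.≤ constant d *ℕ lg n ^ 1
  constant-exact d n = begin
    112                              ≤⟨ ℕ.m≤m+n 112 119 ⟩
    231                              ≤⟨ ℕ.m≤m*n 231 (suc d) ⟩
    constant d                       ≤⟨ ℕ.m≤m*n (constant d) (lg n ^ 1) ⟩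
    constant d *ℕ lg n ^ 1           ∎
    where open ℕ.≤-Reasoning

  solution : ∀ k d .{{_ : NonZero k}} α → 1ℚ < α → ∀ n .{{_ : NonZero n}} (⟦_⟧ : Word k n → ℚ) →
             Solution k d n (constant d *ℕ lg n ^ 1) α ⟦_⟧
  solution k d α 1<α n@(suc n') ⟦_⟧ = by-size (ℕ→ℚ 16 ≤? α)
    where
    C = constant d *ℕ lg n ^ 1
    from-bracket : Σ[ q ∈ ℕ ] (ℕ→ℚ (16 *ℕ suc q) ≤ α × α ≤ ℕ→ℚ ((16 ℕ.+ 16) *ℕ suc q)) → Solution k d n C α ⟦_⟧
    from-bracket (q' , lo , hi) = sampling-solution k d n' ⟦_⟧ α 1<α C q' lo (16 ℕ.+ 16) hi (constant-large d n)
    by-size : Dec (ℕ→ℚ 16 ≤ α) → Solution k d n C α ⟦_⟧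
    by-size (yes 16≤α) = from-bracket (bracket 16 α 16≤α)
    by-size (no 16≰α)  = exact-solution k d n' ⟦_⟧ α 1<α C 16 (constant-exact d n) (ℚ.<⇒≤ (ℚ.≰⇒> 16≰α))

open import Data.Fin.Base using (Fin)
open import Data.List.Base using (List)
open import Data.Nat.Base using (ℕ; NonZero; _^_) renaming (_*_ to _*ℕ_)
open import Data.Product.Base using (_×_; _,_; Σ-syntax)
open import Data.Rational.Base using (ℚ; 1ℚ; _*_; _≤_; _<_; _⊔_)
open import Function.Metric.Rational using (IsMetric)
open import Relation.Binary.PropositionalEquality.Core using (_≡_)
open Assembly using (constant; solution)

theorem1p1 : (k d : ℕ) → .{{_ : NonZero k}} →
    Σ[ C ∈ ℕ ] Σ[ c ∈ ℕ ]
    ((α : ℚ) → 1ℚ < α →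
    (n : ℕ) → .{{_ : NonZero n}} → (⟦_⟧ : Word k n → ℚ) →
    Σ[ A ∈ StreamingAlgorithm (Word k n) (Entry k n) ℚ ]
    ((ℕ→ℚ (StreamingAlgorithm.space A) * α ≤ ℕ→ℚ (C *ℕ lg n ^ c) * (ℕ→ℚ n ⊔ α)) ×
    ((w : Fin n → Fin n → ℚ) → IsMetric _≡_ w →
    (σ : List (Entry k n)) → IsMetricStream k n ⟦_⟧ w σ →
    (m : ℚ) → IsMST w m →
    FailsAtMost1/ (n ^ d) (λ r → approximates? α m (StreamingAlgorithm.run A σ r)))))
theorem1p1 k d = constant d , 1 , λ α 1<α n ⟦_⟧ → solution k d α 1<α n ⟦_⟧
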